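{- Let $p$ be a prime and let $S=\{(a,b)\in\mathbb{F}_p^2 \mid b<a\}$, where elements of $\mathbb{F}_p$ are identified with the integers $0,1,\ldots,p-1$ for the purpose of the comparison $b<a$. Let $T\subseteq\mathbb{F}_p^2$ be a set which is equidistributed in exactly $p-2$ directions. If $|T|=\frac{p(p-1)}{2}$, then $T=\alpha(S)$ for some $\alpha\in AGL(2,p)$; and if $|T|=\frac{p(p+1)}{2}$, then $T=\alpha'(S^c)$ for some $\alpha'\in AGL(2,p)$, where $S^c=\mathbb{F}_p^2\setminus S$ is the complement of $S$.
   Context: $\mathbb{F}_p$ is the field with $p$ elements. A direction is an equivalence class of nonzero vectors of $\mathbb{F}_p^2$ under multiplication by nonzero scalars; there are $p+1$ directions, and each corresponds to a class of $p$ parallel affine lines. A set $T\subseteq\mathbb{F}_p^2$ is equidistributed in a direction if all $p$ lines parallel to that direction intersect $T$ in the same number of points. $AGL(2,p)$ is the group of invertible affine transformations of $\mathbb{F}_p^2$. -}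

module Defs where

open import Level using (0ℓ)
open import Data.Nat.Base
  using (ℕ; _+_; _*_; _<_; NonZero; ≢-nonZero; >-nonZero⁻¹; nonTrivial⇒n>1)
open import Data.Nat.Properties using (*-assoc; *-comm; *-identityˡ)
open import Data.Nat.DivMod
  using (_%_; _mod_; m%n<n; m<n⇒m%n≡m; m%n%n≡m%n; %-distribˡ-*; [m+kn]%n≡m%n)
open import Data.Nat.Coprimality using (prime⇒coprime; coprime-Bézout)
open import Data.Nat.GCD using (module Bézout)
open import Data.Nat.Primality using (Prime; prime⇒nonZero; prime⇒nonTrivial)
open import Data.Nat.Tactic.RingSolver using (solve-∀)
open import Data.Fin.Base using (Fin; toℕ) renaming (_<_ to _<ᶠ_)
open import Data.Fin.Properties using (toℕ-injective; toℕ-fromℕ<; toℕ<n; any?; _≟_)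
open import Data.List.Base using (List; length; filter; allFin; cartesianProduct)
import Data.List.Membership.Setoid as Membership
import Data.List.Relation.Unary.Unique.Setoid as UniqueSetoid
open import Data.Product.Base using (Σ; ∃; _×_; _,_; proj₁; proj₂)
open import Data.Product.Properties using (≡-dec)
open import Function.Bundles using (_⇔_)
open import Function.Definitions using (Inverseᵇ)
open import Relation.Binary.Bundles using (Setoid)
open import Relation.Binary.PropositionalEquality
  using (_≡_; _≢_; refl; sym; trans; cong; cong₂; module ≡-Reasoning)
open import Relation.Unary using (Pred; Decidable)
open import Relation.Unary.Properties using (_∩?_)

module Plane (p : ℕ) (p-prime : Prime p) where

  private
    instance
      p≢0 : NonZero p
      p≢0 = prime⇒nonZero p-prime

  -- 𝔽ₚ is carried by the canonical representatives 0, 1, …, p - 1, with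
  -- arithmetic modulo p.
  𝔽 : Set
  𝔽 = Fin p

  infixl 6 _+ᶠ_ _+ᵛ_
  infixl 7 _*ᶠ_ _·_

  0ᶠ 1ᶠ : 𝔽
  0ᶠ = 0 mod p
  1ᶠ = 1 mod p

  _+ᶠ_ _*ᶠ_ : 𝔽 → 𝔽 → 𝔽
  x +ᶠ y = (toℕ x + toℕ y) mod p
  x *ᶠ y = (toℕ x * toℕ y) mod p

  𝔽² : Set
  𝔽² = 𝔽 × 𝔽

  0ᵛ : 𝔽²
  0ᵛ = 0ᶠ , 0ᶠ

  _+ᵛ_ : 𝔽² → 𝔽² → 𝔽²
  (a , b) +ᵛ (c , d) = (a +ᶠ c) , (b +ᶠ d)

  _·_ : 𝔽 → 𝔽² → 𝔽²
  t · (a , b) = (t *ᶠ a) , (t *ᶠ b)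

  toℕ-mod : ∀ m → toℕ (m mod p) ≡ m % p
  toℕ-mod m = toℕ-fromℕ< (m%n<n m p)

  mod-cong : ∀ {m n} → m % p ≡ n % p → m mod p ≡ n mod p
  mod-cong {m} {n} eq =
    toℕ-injective (trans (toℕ-mod m) (trans eq (sym (toℕ-mod n))))

  toℕ-% : ∀ (x : 𝔽) → toℕ x % p ≡ toℕ x
  toℕ-% x = m<n⇒m%n≡m (toℕ<n x)

  %-absorbˡ : ∀ m n → (m % p * n) % p ≡ (m * n) % p
  %-absorbˡ m n = begin
    (m % p * n) % p              ≡⟨ %-distribˡ-* (m % p) n p ⟩
    (m % p % p * (n % p)) % p    ≡⟨ cong (λ k → (k * (n % p)) % p) (m%n%n≡m%n m p) ⟩
    (m % p * (n % p)) % p        ≡⟨ %-distribˡ-* m n p ⟨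
    (m * n) % p                  ∎
    where open ≡-Reasoning

  *ᶠ-assoc : ∀ x y z → (x *ᶠ y) *ᶠ z ≡ x *ᶠ (y *ᶠ z)
  *ᶠ-assoc x y z = mod-cong (begin
    (toℕ (x *ᶠ y) * c) % p       ≡⟨ cong (λ k → (k * c) % p) (toℕ-mod (a * b)) ⟩
    ((a * b) % p * c) % p        ≡⟨ %-absorbˡ (a * b) c ⟩
    (a * b * c) % p              ≡⟨ cong (_% p) (trans (*-assoc a b c) (*-comm a (b * c))) ⟩
    (b * c * a) % p              ≡⟨ %-absorbˡ (b * c) a ⟨
    ((b * c) % p * a) % p        ≡⟨ cong (_% p) (*-comm ((b * c) % p) a) ⟩
    (a * ((b * c) % p)) % p      ≡⟨ cong (λ k → (a * k) % p) (toℕ-mod (b * c)) ⟨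
    (a * toℕ (y *ᶠ z)) % p       ∎)
    where
    open ≡-Reasoning
    a = toℕ x
    b = toℕ y
    c = toℕ z

  toℕ-1ᶠ : toℕ 1ᶠ ≡ 1
  toℕ-1ᶠ = trans (toℕ-mod 1) (m<n⇒m%n≡m (nonTrivial⇒n>1 p))
    where instance _ = prime⇒nonTrivial p-prime

  toℕ-0ᶠ : toℕ 0ᶠ ≡ 0
  toℕ-0ᶠ = trans (toℕ-mod 0) (m<n⇒m%n≡m (>-nonZero⁻¹ p))

  *ᶠ-identityˡ : ∀ x → 1ᶠ *ᶠ x ≡ x
  *ᶠ-identityˡ x = toℕ-injective (begin
    toℕ (1ᶠ *ᶠ x)          ≡⟨ toℕ-mod _ ⟩
    (toℕ 1ᶠ * toℕ x) % p   ≡⟨ cong (λ k → (k * toℕ x) % p) toℕ-1ᶠ ⟩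
    (1 * toℕ x) % p        ≡⟨ cong (_% p) (*-identityˡ (toℕ x)) ⟩
    toℕ x % p              ≡⟨ toℕ-% x ⟩
    toℕ x                  ∎)
    where open ≡-Reasoning

  1ᶠ≢0ᶠ : 1ᶠ ≢ 0ᶠ
  1ᶠ≢0ᶠ eq with trans (sym toℕ-1ᶠ) (trans (cong toℕ eq) toℕ-0ᶠ)
  ... | ()

  inverse-mod : ∀ c → NonZero c → c < p → ∃ λ r → (r * c) % p ≡ 1 % p
  inverse-mod c c≢0 c<p with coprime-Bézout (prime⇒coprime p-prime {{c≢0}} c<p)
  ... | Bézout.-+ x y eq = y , trans (cong (_% p) (sym eq)) ([m+kn]%n≡m%n 1 x p)
  ... | Bézout.+- x y eq = y * (y * c) , (begin
    (y * (y * c) * c) % p            ≡⟨ cong (_% p) (shuffle y c) ⟩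
    (k * k) % p                      ≡⟨ [m+kn]%n≡m%n (k * k) x p ⟨
    (k * k + x * p) % p              ≡⟨ cong (λ n → (k * k + n) % p) eq ⟨
    (k * k + (1 + k)) % p            ≡⟨ cong (_% p) (expand k) ⟩
    (1 + k * (1 + k)) % p            ≡⟨ cong (λ n → (1 + k * n) % p) eq ⟩
    (1 + k * (x * p)) % p            ≡⟨ cong (λ n → (1 + n) % p) (*-assoc k x p) ⟨
    (1 + k * x * p) % p              ≡⟨ [m+kn]%n≡m%n 1 (k * x) p ⟩
    1 % p                            ∎)
    where
    open ≡-Reasoning
    k = y * c
    shuffle : ∀ y c → y * (y * c) * c ≡ (y * c) * (y * c)
    shuffle = solve-∀
    expand : ∀ k → k * k + (1 + k) ≡ 1 + k * (1 + k)
    expand = solve-∀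

  *ᶠ-inverse : ∀ c → c ≢ 0ᶠ → ∃ λ d → d *ᶠ c ≡ 1ᶠ
  *ᶠ-inverse c c≢0 =
    let r , eq = inverse-mod (toℕ c)
                   (≢-nonZero λ q → c≢0 (toℕ-injective (trans q (sym toℕ-0ᶠ))))
                   (toℕ<n c)
    in r mod p , mod-cong
         (trans (cong (λ k → (k * toℕ c) % p) (toℕ-mod r))
                (trans (%-absorbˡ r (toℕ c)) eq))

  *ᶠ-zeroˡ : ∀ x → 0ᶠ *ᶠ x ≡ 0ᶠ
  *ᶠ-zeroˡ x = cong (λ k → (k * toℕ x) mod p) toℕ-0ᶠ

  *ᶠ-nonzero : ∀ {c d} → c ≢ 0ᶠ → d ≢ 0ᶠ → c *ᶠ d ≢ 0ᶠ
  *ᶠ-nonzero {c} {d} c≢0 d≢0 cd≡0 = d≢0 (begin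
    d                ≡⟨ *ᶠ-identityˡ d ⟨
    1ᶠ *ᶠ d          ≡⟨ cong (_*ᶠ d) (proj₂ inv) ⟨
    e *ᶠ c *ᶠ d      ≡⟨ *ᶠ-assoc e c d ⟩
    e *ᶠ (c *ᶠ d)    ≡⟨ cong (e *ᶠ_) cd≡0 ⟩
    e *ᶠ 0ᶠ          ≡⟨ cong (_mod p) (*-comm (toℕ e) (toℕ 0ᶠ)) ⟩
    0ᶠ *ᶠ e          ≡⟨ *ᶠ-zeroˡ e ⟩
    0ᶠ               ∎)
    where
    open ≡-Reasoning
    inv = *ᶠ-inverse c c≢0
    e = proj₁ inv

  ·-identity : ∀ v → 1ᶠ · v ≡ v
  ·-identity (a , b) = cong₂ _,_ (*ᶠ-identityˡ a) (*ᶠ-identityˡ b)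

  ·-assoc : ∀ c d v → (c *ᶠ d) · v ≡ c · (d · v)
  ·-assoc c d (a , b) = cong₂ _,_ (*ᶠ-assoc c d a) (*ᶠ-assoc c d b)

  _∥_ : 𝔽² → 𝔽² → Set
  v ∥ w = ∃ λ c → c ≢ 0ᶠ × w ≡ c · v

  ∥-refl : ∀ {v} → v ∥ v
  ∥-refl {v} = 1ᶠ , 1ᶠ≢0ᶠ , sym (·-identity v)

  ∥-sym : ∀ {v w} → v ∥ w → w ∥ v
  ∥-sym {v} (c , c≢0 , refl) =
    let d , dc≡1 = *ᶠ-inverse c c≢0
    in d
     , (λ d≡0 → 1ᶠ≢0ᶠ (trans (sym dc≡1) (trans (cong (_*ᶠ c) d≡0) (*ᶠ-zeroˡ c))))
     , sym (trans (sym (·-assoc d c v)) (trans (cong (_· v) dc≡1) (·-identity v)))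

  ∥-trans : ∀ {u v w} → u ∥ v → v ∥ w → u ∥ w
  ∥-trans {u} (c , c≢0 , refl) (d , d≢0 , refl) =
    d *ᶠ c , *ᶠ-nonzero d≢0 c≢0 , sym (·-assoc d c u)

  Direction : Setoid 0ℓ 0ℓ
  Direction = record
    { Carrier       = Σ 𝔽² (_≢ 0ᵛ)
    ; _≈_           = λ d e → proj₁ d ∥ proj₁ e
    ; isEquivalence = record { refl = ∥-refl ; sym = ∥-sym ; trans = ∥-trans }
    }

  open Membership Direction using (_∈_)
  open UniqueSetoid Direction using (Unique)

  points : List 𝔽²
  points = cartesianProduct (allFin p) (allFin p)

  card : {P : Pred 𝔽² 0ℓ} → Decidable P → ℕ
  card P? = length (filter P? points)

  Line : 𝔽² → 𝔽² → Pred 𝔽² 0ℓ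
  Line u v w = ∃ λ t → w ≡ u +ᵛ t · v

  line? : ∀ u v → Decidable (Line u v)
  line? u v w = any? λ t → ≡-dec _≟_ _≟_ w (u +ᵛ t · v)

  -- The lines parallel to v are the lines Line u v, u ranging over all points
  -- (each of the p lines arises from p values of u).
  Equidistributed : {T : Pred 𝔽² 0ℓ} → Decidable T → Setoid.Carrier Direction → Set
  Equidistributed T? (v , _) =
    ∀ u u′ → card (T? ∩? line? u v) ≡ card (T? ∩? line? u′ v)

  -- Unique and _∈_ are taken up to equality of directions, so ds enumerates
  -- the equidistributed equivalence classes without repetition.
  EquidistributedInExactly : ℕ → {T : Pred 𝔽² 0ℓ} → Decidable T → Set
  EquidistributedInExactly k T? =
    ∃ λ ds → length ds ≡ k × Unique ds × (∀ d → d ∈ ds ⇔ Equidistributed T? d)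

  S : Pred 𝔽² 0ℓ
  S (a , b) = b <ᶠ a

  record AffineMap : Set where
    field
      row₁ row₂ translation : 𝔽²

    apply : 𝔽² → 𝔽²
    apply v = (dot row₁ v , dot row₂ v) +ᵛ translation
      where
      dot : 𝔽² → 𝔽² → 𝔽
      dot (a , b) (c , d) = a *ᶠ c +ᶠ b *ᶠ d

  record AGL : Set where
    field
      to from : AffineMap
      inverse : Inverseᵇ _≡_ _≡_ (AffineMap.apply to) (AffineMap.apply from)

    ⟦_⟧ : 𝔽² → 𝔽²
    ⟦_⟧ = AffineMap.apply to

  image : AGL → Pred 𝔽² 0ℓ → Pred 𝔽² 0ℓ
  image α P w = ∃ λ v → P v × w ≡ AGL.⟦_⟧ α v

{-# OPTIONS --safe #-}
module Submission where

-- Summing |T ∩ ℓ| over the p + 1 lines ℓ through a point u counts u itself p + 1 times and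
-- every other point once, which gives |T| + p · [u ∈ T]. The p - 2 equidistributed directions
-- contribute |T| / p each, so when |T| = p (p - 1) / 2 the three remaining directions satisfy
-- A + B + C = p - 1 + p · [u ∈ T]. In coordinates adapted to them, A depends on y only, B on x
-- only and C on x - y only; modulo p the relation therefore forces all three to be affine,
-- with slopes κ, -κ and κ. The slope is nonzero, since otherwise all three would take only the
-- values 0 and p. Hence A, B and C run over all residues, and as their sums equal 0 + 1 + ⋯ +
-- (p - 1) they coincide with their residues. Then u ∈ T iff A + B ≥ p, i.e. iff -1 - A < B as
-- residues, which is S up to an affine change of coordinates. The second case follows by
-- passing to the complement.

open import Level using (0ℓ)
open import Algebra.Bundles using (CommutativeRing)
import Algebra.Properties.Ring
import Algebra.Solver.Ring as RingSolver
open import Algebra.Solver.Ring.AlmostCommutativeRing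
  using (AlmostCommutativeRing; fromCommutativeRing; _-Raw-AlmostCommutative⟶_)
open import Data.Bool.Base using (if_then_else_)
open import Data.Fin.Base using (Fin; toℕ; zero; suc; opposite)
open import Data.Fin.Properties using (_≟_; toℕ-injective; toℕ<n; opposite-prop)
open import Data.Integer.Base as ℤ using (ℤ; 0ℤ; _%ℕ_; _/ℕ_)
import Data.Integer.DivMod as ℤ
import Data.Integer.Properties as ℤ
import Data.Integer.Solver as ℤ
open import Data.List.Base using
  (List; []; _∷_; _++_; map; filter; length; allFin; cartesianProduct)
open import Data.List.Membership.DecPropositional as DecMembership using ()
open import Data.List.Membership.Propositional using (_∈_; _∉_)
open import Data.List.Membership.Propositional.Properties
open import Data.List.Membership.Propositional.Properties.WithK using (unique∧set⇒bag)
import Data.List.Membership.Setoid as Membership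
open import Data.List.Properties using
  (map-cong-local; map-∘; map-++; map-tabulate; length-map; length-tabulate; length-++)
open import Data.List.Relation.Binary.BagAndSetEquality using (∼bag⇒↭)
open import Data.List.Relation.Binary.Permutation.Propositional using (_↭_)
open import Data.List.Relation.Binary.Permutation.Propositional.Properties using (map⁺; ↭-length)
open import Data.List.Relation.Unary.All as All using ([]; _∷_)
import Data.List.Relation.Unary.All.Properties as All
open import Data.List.Relation.Unary.AllPairs using ([]; _∷_)
open import Data.List.Relation.Unary.Any as Any using (here; there)
open import Data.List.Relation.Unary.Unique.Propositional using (Unique)
import Data.List.Relation.Unary.Unique.Propositional.Properties as Unique
import Data.List.Relation.Unary.Unique.Setoid.Properties as UniqueSetoid
open import Data.Maybe.Base using (Maybe; just; nothing)
import Data.Maybe.Properties as Maybe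
open import Data.Nat.Base as ℕ using
  (ℕ; zero; suc; _+_; _*_; _∸_; _/_; _%_; _≤_; _<_; z≤n; s≤s; NonZero; nonTrivial⇒n>1)
import Data.Nat.DivMod as ℕ
open import Data.Nat.ListAction using (sum)
open import Data.Nat.ListAction.Properties using (sum-++; sum-↭)
open import Data.Nat.Primality using (Prime; prime⇒nonZero; prime⇒nonTrivial)
import Data.Nat.Properties as ℕ
open import Data.Nat.Tactic.RingSolver using (solve-∀)
open import Data.Product.Base using (∃; _×_; _,_; proj₁; proj₂)
open import Data.Sum.Base using (inj₁; inj₂)
open import Function.Base using (_∘_; id)
open import Function.Bundles using (_⇔_; mk⇔; Equivalence)
open import Function.Properties.Equivalence using () renaming (trans to ⇔-trans)
open import Relation.Binary.Bundles using (Setoid)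
open import Relation.Binary.PropositionalEquality
open import Relation.Nullary using (Dec; yes; no; does; ¬_; contradiction; ¬?)
open import Relation.Nullary.Decidable using (decidable-stable)
open import Relation.Unary using (Pred; Decidable; _≐_; ∁)
open import Relation.Unary.Properties using (_∩?_; ∁?)
open import Defs

-- Finite sums over lists, reindexing, and indicator functions.

module Sums where
  private variable
    A B : Set

  ∑ : List A → (A → ℕ) → ℕ
  ∑ xs f = sum (map f xs)

  ∑-cong∈ : {f g : A → ℕ} (xs : List A) → (∀ {x} → x ∈ xs → f x ≡ g x) → ∑ xs f ≡ ∑ xs g
  ∑-cong∈ xs f≗g = cong sum (map-cong-local (All.tabulate f≗g))

  ∑-cong : {f g : A → ℕ} (xs : List A) → (∀ x → f x ≡ g x) → ∑ xs f ≡ ∑ xs g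
  ∑-cong xs f≗g = ∑-cong∈ xs (λ {x} _ → f≗g x)

  ∑-++ : (f : A → ℕ) (xs ys : List A) → ∑ (xs ++ ys) f ≡ ∑ xs f + ∑ ys f
  ∑-++ f xs ys = trans (cong sum (map-++ f xs ys)) (sum-++ (map f xs) (map f ys))

  ∑-map : (f : B → ℕ) (h : A → B) (xs : List A) → ∑ (map h xs) f ≡ ∑ xs (f ∘ h)
  ∑-map f h xs = cong sum (sym (map-∘ xs))

  ∑-const : (xs : List A) (c : ℕ) → ∑ xs (λ _ → c) ≡ length xs * c
  ∑-const []       c = refl
  ∑-const (x ∷ xs) c = cong (c +_) (∑-const xs c)

  ∑-+ : (f g : A → ℕ) (xs : List A) → ∑ xs (λ x → f x + g x) ≡ ∑ xs f + ∑ xs g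
  ∑-+ f g []       = refl
  ∑-+ f g (x ∷ xs) = trans (cong (f x + g x +_) (∑-+ f g xs)) (exchange (f x) (g x) _ _)
    where
    exchange : ∀ a b c d → a + b + (c + d) ≡ a + c + (b + d)
    exchange = solve-∀

  ∑-* : (c : ℕ) (f : A → ℕ) (xs : List A) → ∑ xs (λ x → c * f x) ≡ c * ∑ xs f
  ∑-* c f []       = sym (ℕ.*-zeroʳ c)
  ∑-* c f (x ∷ xs) = trans (cong (c * f x +_) (∑-* c f xs)) (sym (ℕ.*-distribˡ-+ c (f x) _))

  ∑-swap : (f : A → B → ℕ) (xs : List A) (ys : List B) →
           ∑ xs (λ x → ∑ ys (f x)) ≡ ∑ ys (λ y → ∑ xs (λ x → f x y))
  ∑-swap f []       ys = sym (trans (∑-const ys 0) (ℕ.*-zeroʳ (length ys)))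
  ∑-swap f (x ∷ xs) ys =
    trans (cong (∑ ys (f x) +_) (∑-swap f xs ys)) (sym (∑-+ (f x) _ ys))

  ∑-cartesianProduct : (f : A × B → ℕ) (xs : List A) (ys : List B) →
                       ∑ (cartesianProduct xs ys) f ≡ ∑ xs (λ x → ∑ ys (λ y → f (x , y)))
  ∑-cartesianProduct f []       ys = refl
  ∑-cartesianProduct f (x ∷ xs) ys = trans (∑-++ f (map (x ,_) ys) _)
    (cong₂ _+_ (∑-map f (x ,_) ys) (∑-cartesianProduct f xs ys))

  -- Without repetitions every multiplicity is 0 or 1, so membership alone determines the list up to
  -- order. All reindexings of sums below rest on this.
  unique-↭ : {xs ys : List A} → Unique xs → Unique ys → (∀ {x} → x ∈ xs ⇔ x ∈ ys) → xs ↭ ys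
  unique-↭ uxs uys xs≈ys = ∼bag⇒↭ (unique∧set⇒bag uxs uys xs≈ys)

  ∑-↭ : (f : A → ℕ) {xs ys : List A} → xs ↭ ys → ∑ xs f ≡ ∑ ys f
  ∑-↭ f xs↭ys = sum-↭ (map⁺ f xs↭ys)

  map-↭ : {xs : List A} {ys : List B} (h : A → B) → Unique xs → Unique ys →
          (∀ {x y} → h x ≡ h y → x ≡ y) → (∀ {x} → x ∈ xs → h x ∈ ys) →
          (∀ {y} → y ∈ ys → ∃ λ x → x ∈ xs × y ≡ h x) → map h xs ↭ ys
  map-↭ h uxs uys inj to from = unique-↭ (Unique.map⁺ inj uxs) uys
    (mk⇔ (λ z∈ → let x , x∈ , eq = ∈-map⁻ h z∈ in subst (_∈ _) (sym eq) (to x∈))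
         (λ z∈ → let x , x∈ , eq = from z∈ in subst (_∈ _) (sym eq) (∈-map⁺ h x∈)))

  ∑-bijection : {xs : List A} (f : A → ℕ) (h h⁻¹ : A → A) → Unique xs → (∀ x → x ∈ xs) →
                (∀ x → h (h⁻¹ x) ≡ x) → (∀ x → h⁻¹ (h x) ≡ x) → ∑ xs (f ∘ h) ≡ ∑ xs f
  ∑-bijection {xs = xs} f h h⁻¹ uxs full hh⁻¹ h⁻¹h = trans (sym (∑-map f h xs))
    (∑-↭ f (map-↭ h uxs uxs
      (λ {x} {y} eq → trans (sym (h⁻¹h x)) (trans (cong h⁻¹ eq) (h⁻¹h y)))
      (λ _ → full _) (λ {y} _ → h⁻¹ y , full _ , sym (hh⁻¹ y))))

  𝟙 : {P : Set} → Dec P → ℕ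
  𝟙 P? = if does P? then 1 else 0

  𝟙-yes : {P : Set} (P? : Dec P) → P → 𝟙 P? ≡ 1
  𝟙-yes (yes _) _  = refl
  𝟙-yes (no ¬p) p  = contradiction p ¬p

  𝟙-no : {P : Set} (P? : Dec P) → ¬ P → 𝟙 P? ≡ 0
  𝟙-no (yes p) ¬p = contradiction p ¬p
  𝟙-no (no _)  _  = refl

  length-filter : {P : Pred A 0ℓ} (P? : Decidable P) (xs : List A) →
                  length (filter P? xs) ≡ ∑ xs (𝟙 ∘ P?)
  length-filter P? []       = refl
  length-filter P? (x ∷ xs) with P? x
  ... | yes _ = cong suc (length-filter P? xs)
  ... | no _  = length-filter P? xs

  ∑-mono : {f g : A → ℕ} → (∀ x → f x ≤ g x) → (xs : List A) → ∑ xs f ≤ ∑ xs g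
  ∑-mono f≤g []       = z≤n
  ∑-mono f≤g (x ∷ xs) = ℕ.+-mono-≤ (f≤g x) (∑-mono f≤g xs)

  -- A strict inequality at one entry could not be made up for elsewhere. At the head, equality of
  -- the totals together with the inequality on the tail yields `g x ≤ f x`; cancelling the head
  -- then passes equality on to the tail.
  ∑-≤-≡ : {f g : A → ℕ} → (∀ x → f x ≤ g x) → (xs : List A) → ∑ xs f ≡ ∑ xs g →
          ∀ {x} → x ∈ xs → f x ≡ g x
  ∑-≤-≡ {f = f} {g} f≤g (x ∷ xs) eq = λ where
      (here refl) → ℕ.≤-antisym (f≤g x) gx≤fx
      (there x∈)  → ∑-≤-≡ f≤g xs rest x∈
    where
    gx≤fx : g x ≤ f x
    gx≤fx = ℕ.+-cancelʳ-≤ (∑ xs g) (g x) (f x)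
      (ℕ.≤-trans (ℕ.≤-reflexive (sym eq)) (ℕ.+-monoʳ-≤ (f x) (∑-mono f≤g xs)))
    fx≡gx = ℕ.≤-antisym (f≤g x) gx≤fx
    rest : ∑ xs f ≡ ∑ xs g
    rest = ℕ.+-cancelˡ-≡ (f x) _ _ (trans eq (cong (_+ ∑ xs g) (sym fx≡gx)))

  ∑-allFin-suc : ∀ n (f : Fin (suc n) → ℕ) → ∑ (allFin (suc n)) f ≡ f zero + ∑ (allFin n) (f ∘ suc)
  ∑-allFin-suc n f = cong (λ l → f zero + sum l)
    (trans (map-tabulate suc f) (sym (map-tabulate id (f ∘ suc))))

  -- Gauss's sum, doubled to avoid division. At `n = 0` the truncated `n ∸ 1` is harmless because
  -- the other factor vanishes.
  2∑toℕ : ∀ n → 2 * ∑ (allFin n) toℕ ≡ n * (n ∸ 1)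
  2∑toℕ zero    = refl
  2∑toℕ (suc n) = begin
    2 * ∑ (allFin (suc n)) toℕ            ≡⟨ cong (2 *_) (∑-allFin-suc n toℕ) ⟩
    2 * ∑ (allFin n) (λ i → 1 + toℕ i)    ≡⟨ cong (2 *_) (∑-+ (λ _ → 1) toℕ (allFin n)) ⟩
    2 * (∑ (allFin n) (λ _ → 1) + s)      ≡⟨ cong (λ k → 2 * (k + s)) ones ⟩
    2 * (n + s)                           ≡⟨ ℕ.*-distribˡ-+ 2 n s ⟩
    2 * n + 2 * s                         ≡⟨ cong (2 * n +_) (2∑toℕ n) ⟩
    2 * n + n * (n ∸ 1)                   ≡⟨ gauss n ⟩
    suc n * n                             ∎
    where
    open ≡-Reasoning
    s = ∑ (allFin n) toℕ
    ones : ∑ (allFin n) (λ _ → 1) ≡ n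
    ones = trans (∑-const (allFin n) 1)
      (trans (ℕ.*-identityʳ _) (length-tabulate (id {A = Fin n})))
    poly : ∀ m → 2 * (1 + m) + (1 + m) * m ≡ (2 + m) * (1 + m)
    poly = solve-∀
    gauss : ∀ n → 2 * n + n * (n ∸ 1) ≡ suc n * n
    gauss zero    = refl
    gauss (suc m) = poly m

  module _ {q a b c y : ℕ} (y+a≡q : y + a ≡ q) where
    open ℕ.≤-Reasoning

    -- Used with `q = p ∸ 1`, where `a`, `b`, `c` are the three special line sums at a point of `T`.
    -- As `c` is at most `q`, the sum `a + b` is at least `q + 1`, and `y` is `q - a`.
    overflow⇒< : c ≤ q → a + b + c ≡ q + suc q → y < b
    overflow⇒< c≤q sum≡ = ℕ.+-cancelʳ-≤ a _ _ (ℕ.+-cancelʳ-≤ c _ _ (begin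
      suc y + a + c    ≡⟨ cong (λ n → suc n + c) y+a≡q ⟩
      suc q + c        ≤⟨ ℕ.+-monoʳ-≤ (suc q) c≤q ⟩
      suc q + q        ≡⟨ ℕ.+-comm (suc q) q ⟩
      q + suc q        ≡⟨ sum≡ ⟨
      a + b + c        ≡⟨ cong (_+ c) (ℕ.+-comm a b) ⟩
      b + a + c        ∎))

    -- The counterpart for a point outside `T`: now `a + b` is at most `q`, hence `b` is at most
    -- `q - a = y`.
    no-overflow⇒≮ : a + b + c ≡ q → ¬ y < b
    no-overflow⇒≮ sum≡ y<b = ℕ.<-irrefl refl (begin
      suc q            ≡⟨ cong suc y+a≡q ⟨
      suc y + a        ≤⟨ ℕ.+-monoˡ-≤ a y<b ⟩
      b + a            ≡⟨ ℕ.+-comm b a ⟩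
      a + b            ≤⟨ ℕ.m≤m+n (a + b) c ⟩
      a + b + c        ≡⟨ sum≡ ⟩
      q                ∎)

open Sums

-- The commutative ring structure on residues modulo p, and a ring solver for it.

module Field (p : ℕ) (p-prime : Prime p) where
  open import Data.Integer.Base using (+_; -[1+_])
  open Plane p p-prime
  open ≡-Reasoning

  private instance
    p≢0 : NonZero p
    p≢0 = prime⇒nonZero p-prime

  -- The reduction homomorphism, which also interprets the integer coefficients of the ring solver.
  ⟦_⟧ : ℤ → 𝔽
  ⟦ i ⟧ = (i %ℕ p) ℕ.mod p

  toℕ-⟦⟧ : ∀ i → toℕ ⟦ i ⟧ ≡ i %ℕ p
  toℕ-⟦⟧ i = trans (toℕ-mod _) (ℕ.m<n⇒m%n≡m (ℤ.n%ℕd<d i p))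

  -- The quotient `k` may have either sign. If it is negative, the equation is turned around, so
  -- that in both cases a natural multiple of `p` is added to one side.
  mod-congruent : ∀ m n k → + m ≡ + n ℤ.+ k ℤ.* + p → m ℕ.mod p ≡ n ℕ.mod p
  mod-congruent m n (+ k) eq = mod-cong (trans (cong (ℕ._% p) m≡) (ℕ.[m+kn]%n≡m%n n k p))
    where
    m≡ : m ≡ n ℕ.+ k ℕ.* p
    m≡ = ℤ.+-injective (begin
      + m                        ≡⟨ eq ⟩
      + n ℤ.+ + k ℤ.* + p        ≡⟨ cong (λ j → + n ℤ.+ j) (ℤ.pos-* k p) ⟨
      + n ℤ.+ + (k ℕ.* p)        ≡⟨ ℤ.pos-+ n (k ℕ.* p) ⟨
      + (n ℕ.+ k ℕ.* p)          ∎)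
  mod-congruent m n -[1+ k ] eq =
    mod-cong (sym (trans (cong (ℕ._% p) n≡) (ℕ.[m+kn]%n≡m%n m (suc k) p)))
    where
    open ℤ.+-*-Solver
    n≡ : n ≡ m ℕ.+ suc k ℕ.* p
    n≡ = ℤ.+-injective (begin
      + n
        ≡⟨ solve 3 (λ n k p → n := n :+ (:- k) :* p :+ k :* p) refl (+ n) (+ suc k) (+ p) ⟩
      + n ℤ.+ -[1+ k ] ℤ.* + p ℤ.+ + suc k ℤ.* + p
        ≡⟨ cong₂ ℤ._+_ (sym eq) (sym (ℤ.pos-* (suc k) p)) ⟩
      + m ℤ.+ + (suc k ℕ.* p)
        ≡⟨ ℤ.pos-+ m (suc k ℕ.* p) ⟨
      + (m ℕ.+ suc k ℕ.* p) ∎)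

  -- Subtracting the Euclidean decomposition of `i` from the given equation leaves a congruence
  -- between natural numbers. To show that reduction preserves an operation it then suffices to
  -- exhibit a quotient.
  ⟦⟧-congruent : ∀ i n k → i ≡ + n ℤ.+ k ℤ.* + p → ⟦ i ⟧ ≡ n ℕ.mod p
  ⟦⟧-congruent i n k eq = mod-congruent r n (k ℤ.- q) (begin
    + r
      ≡⟨ solve 2 (λ r s → r := r :+ s :- s) refl (+ r) (q ℤ.* + p) ⟩
    + r ℤ.+ q ℤ.* + p ℤ.- q ℤ.* + p        ≡⟨ cong (ℤ._- q ℤ.* + p) (ℤ.a≡a%ℕn+[a/ℕn]*n i p) ⟨
    i ℤ.- q ℤ.* + p                        ≡⟨ cong (ℤ._- q ℤ.* + p) eq ⟩
    + n ℤ.+ k ℤ.* + p ℤ.- q ℤ.* + p        ≡⟨ regroup (+ n) k q (+ p) ⟩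
    + n ℤ.+ (k ℤ.- q) ℤ.* + p              ∎)
    where
    open ℤ.+-*-Solver
    r = i %ℕ p
    q = i /ℕ p
    regroup = solve 4 (λ n k q p → n :+ k :* p :- q :* p := n :+ (k :- q) :* p) refl

  ⟦+_⟧ : ∀ n → ⟦ + n ⟧ ≡ n ℕ.mod p
  ⟦+ n ⟧ = ⟦⟧-congruent (+ n) n 0ℤ (sym (ℤ.+-identityʳ (+ n)))

  ⟦toℕ⟧ : ∀ x → ⟦ + toℕ x ⟧ ≡ x
  ⟦toℕ⟧ x = toℕ-injective (trans (toℕ-⟦⟧ (+ toℕ x)) (toℕ-% x))

  infix 8 -ᶠ_
  -ᶠ_ : 𝔽 → 𝔽
  -ᶠ x = ⟦ ℤ.- + toℕ x ⟧

  ⟦⟧-+ : ∀ i j → ⟦ i ℤ.+ j ⟧ ≡ ⟦ i ⟧ +ᶠ ⟦ j ⟧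
  ⟦⟧-+ i j = trans
    (⟦⟧-congruent (i ℤ.+ j) (r ℕ.+ s) (q ℤ.+ t) (begin
      i ℤ.+ j
        ≡⟨ cong₂ ℤ._+_ (ℤ.a≡a%ℕn+[a/ℕn]*n i p) (ℤ.a≡a%ℕn+[a/ℕn]*n j p) ⟩
      (+ r ℤ.+ q ℤ.* + p) ℤ.+ (+ s ℤ.+ t ℤ.* + p)
        ≡⟨ regroup (+ r) q (+ s) t (+ p) ⟩
      + r ℤ.+ + s ℤ.+ (q ℤ.+ t) ℤ.* + p
        ≡⟨ cong (ℤ._+ (q ℤ.+ t) ℤ.* + p) (ℤ.pos-+ r s) ⟨
      + (r ℕ.+ s) ℤ.+ (q ℤ.+ t) ℤ.* + p ∎))
    (sym (cong₂ (λ m n → (m ℕ.+ n) ℕ.mod p) (toℕ-⟦⟧ i) (toℕ-⟦⟧ j)))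
    where
    open ℤ.+-*-Solver
    r = i %ℕ p
    q = i /ℕ p
    s = j %ℕ p
    t = j /ℕ p
    regroup = solve 5 (λ r q s t p → (r :+ q :* p) :+ (s :+ t :* p) := r :+ s :+ (q :+ t) :* p) refl

  ⟦⟧-* : ∀ i j → ⟦ i ℤ.* j ⟧ ≡ ⟦ i ⟧ *ᶠ ⟦ j ⟧
  ⟦⟧-* i j = trans
    (⟦⟧-congruent (i ℤ.* j) (r ℕ.* s) k (begin
      i ℤ.* j
        ≡⟨ cong₂ ℤ._*_ (ℤ.a≡a%ℕn+[a/ℕn]*n i p) (ℤ.a≡a%ℕn+[a/ℕn]*n j p) ⟩
      (+ r ℤ.+ q ℤ.* + p) ℤ.* (+ s ℤ.+ t ℤ.* + p)
        ≡⟨ regroup (+ r) q (+ s) t (+ p) ⟩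
      + r ℤ.* + s ℤ.+ k ℤ.* + p
        ≡⟨ cong (ℤ._+ k ℤ.* + p) (ℤ.pos-* r s) ⟨
      + (r ℕ.* s) ℤ.+ k ℤ.* + p ∎))
    (sym (cong₂ (λ m n → (m ℕ.* n) ℕ.mod p) (toℕ-⟦⟧ i) (toℕ-⟦⟧ j)))
    where
    open ℤ.+-*-Solver
    r = i %ℕ p
    q = i /ℕ p
    s = j %ℕ p
    t = j /ℕ p
    k = + r ℤ.* t ℤ.+ q ℤ.* (+ s ℤ.+ t ℤ.* + p)
    regroup = solve 5 (λ r q s t p → (r :+ q :* p) :* (s :+ t :* p) :=
                                     r :* s :+ (r :* t :+ q :* (s :+ t :* p)) :* p) refl

  ⟦⟧-neg : ∀ i → ⟦ ℤ.- i ⟧ ≡ -ᶠ ⟦ i ⟧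
  ⟦⟧-neg i = trans
    (⟦⟧-congruent (ℤ.- i) s (t ℤ.- q) (begin
      ℤ.- i                                    ≡⟨ cong ℤ.-_ (ℤ.a≡a%ℕn+[a/ℕn]*n i p) ⟩
      ℤ.- (+ r ℤ.+ q ℤ.* + p)                  ≡⟨ ℤ.neg-distrib-+ (+ r) (q ℤ.* + p) ⟩
      ℤ.- + r ℤ.- q ℤ.* + p
        ≡⟨ cong (ℤ._- q ℤ.* + p) (ℤ.a≡a%ℕn+[a/ℕn]*n (ℤ.- + r) p) ⟩
      + s ℤ.+ t ℤ.* + p ℤ.- q ℤ.* + p          ≡⟨ regroup (+ s) t q (+ p) ⟩
      + s ℤ.+ (t ℤ.- q) ℤ.* + p                ∎))
    (cong (λ n → (ℤ.- + n) %ℕ p ℕ.mod p) (sym (toℕ-⟦⟧ i)))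
    where
    open ℤ.+-*-Solver
    r = i %ℕ p
    q = i /ℕ p
    s = (ℤ.- + r) %ℕ p
    t = (ℤ.- + r) /ℕ p
    regroup = solve 4 (λ s t q p → s :+ t :* p :- q :* p := s :+ (t :- q) :* p) refl

  -- Since ⟦_⟧ is onto and preserves the operations, the ring laws of 𝔽ₚ are inherited from ℤ.
  𝔽-commutativeRing : CommutativeRing _ _
  𝔽-commutativeRing = record
    { Carrier = 𝔽 ; _≈_ = _≡_ ; _+_ = _+ᶠ_ ; _*_ = _*ᶠ_ ; -_ = -ᶠ_ ; 0# = 0ᶠ ; 1# = 1ᶠ
    ; isCommutativeRing = record
      { isRing = record
        { +-isAbelianGroup = record
          { isGroup = record
            { isMonoid = record
              { isSemigroup = record
                { isMagma = record { isEquivalence = isEquivalence ; ∙-cong = cong₂ _+ᶠ_ }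
                ; assoc = +-assoc }
              ; identity = comm∧idˡ⇒id +ᶠ-comm +-identityˡ }
            ; inverse = comm∧invˡ⇒inv +ᶠ-comm +-inverseˡ
            ; ⁻¹-cong = cong -ᶠ_ }
          ; comm = +ᶠ-comm }
        ; *-cong = cong₂ _*ᶠ_
        ; *-assoc = *ᶠ-assoc
        ; *-identity = comm∧idˡ⇒id *ᶠ-comm *ᶠ-identityˡ
        ; distrib = *ᶠ-distribˡ , comm∧distrˡ⇒distrʳ *ᶠ-comm *ᶠ-distribˡ }
      ; *-comm = *ᶠ-comm } }
    where
    open import Algebra.Consequences.Propositional {A = 𝔽}
      using (comm∧idˡ⇒id; comm∧invˡ⇒inv; comm∧distrˡ⇒distrʳ)
    open import Algebra.Definitions {A = 𝔽} _≡_
    +ᶠ-comm : Commutative _+ᶠ_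
    +ᶠ-comm x y = cong (ℕ._mod p) (ℕ.+-comm (toℕ x) (toℕ y))
    *ᶠ-comm : Commutative _*ᶠ_
    *ᶠ-comm x y = cong (ℕ._mod p) (ℕ.*-comm (toℕ x) (toℕ y))
    +-assoc : Associative _+ᶠ_
    +-assoc x y z = begin
      x +ᶠ y +ᶠ z
        ≡⟨ cong₂ _+ᶠ_ (cong₂ _+ᶠ_ (⟦toℕ⟧ x) (⟦toℕ⟧ y)) (⟦toℕ⟧ z) ⟨
      ⟦ a ⟧ +ᶠ ⟦ b ⟧ +ᶠ ⟦ c ⟧                 ≡⟨ cong (_+ᶠ ⟦ c ⟧) (⟦⟧-+ a b) ⟨
      ⟦ a ℤ.+ b ⟧ +ᶠ ⟦ c ⟧                    ≡⟨ ⟦⟧-+ (a ℤ.+ b) c ⟨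
      ⟦ a ℤ.+ b ℤ.+ c ⟧                       ≡⟨ cong ⟦_⟧ (ℤ.+-assoc a b c) ⟩
      ⟦ a ℤ.+ (b ℤ.+ c) ⟧                     ≡⟨ ⟦⟧-+ a (b ℤ.+ c) ⟩
      ⟦ a ⟧ +ᶠ ⟦ b ℤ.+ c ⟧                    ≡⟨ cong (⟦ a ⟧ +ᶠ_) (⟦⟧-+ b c) ⟩
      ⟦ a ⟧ +ᶠ (⟦ b ⟧ +ᶠ ⟦ c ⟧)
        ≡⟨ cong₂ _+ᶠ_ (⟦toℕ⟧ x) (cong₂ _+ᶠ_ (⟦toℕ⟧ y) (⟦toℕ⟧ z)) ⟩
      x +ᶠ (y +ᶠ z)                           ∎
      where
      a = + toℕ x
      b = + toℕ y
      c = + toℕ z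
    *ᶠ-distribˡ : _*ᶠ_ DistributesOverˡ _+ᶠ_
    *ᶠ-distribˡ x y z = begin
      x *ᶠ (y +ᶠ z)
        ≡⟨ cong₂ _*ᶠ_ (⟦toℕ⟧ x) (cong₂ _+ᶠ_ (⟦toℕ⟧ y) (⟦toℕ⟧ z)) ⟨
      ⟦ a ⟧ *ᶠ (⟦ b ⟧ +ᶠ ⟦ c ⟧)               ≡⟨ cong (⟦ a ⟧ *ᶠ_) (⟦⟧-+ b c) ⟨
      ⟦ a ⟧ *ᶠ ⟦ b ℤ.+ c ⟧                    ≡⟨ ⟦⟧-* a (b ℤ.+ c) ⟨
      ⟦ a ℤ.* (b ℤ.+ c) ⟧                     ≡⟨ cong ⟦_⟧ (ℤ.*-distribˡ-+ a b c) ⟩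
      ⟦ a ℤ.* b ℤ.+ a ℤ.* c ⟧                 ≡⟨ ⟦⟧-+ (a ℤ.* b) (a ℤ.* c) ⟩
      ⟦ a ℤ.* b ⟧ +ᶠ ⟦ a ℤ.* c ⟧              ≡⟨ cong₂ _+ᶠ_ (⟦⟧-* a b) (⟦⟧-* a c) ⟩
      ⟦ a ⟧ *ᶠ ⟦ b ⟧ +ᶠ ⟦ a ⟧ *ᶠ ⟦ c ⟧
        ≡⟨ cong (λ x → x *ᶠ ⟦ b ⟧ +ᶠ x *ᶠ ⟦ c ⟧) (⟦toℕ⟧ x) ⟩
      x *ᶠ ⟦ b ⟧ +ᶠ x *ᶠ ⟦ c ⟧
        ≡⟨ cong₂ (λ y z → x *ᶠ y +ᶠ x *ᶠ z) (⟦toℕ⟧ y) (⟦toℕ⟧ z) ⟩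
      x *ᶠ y +ᶠ x *ᶠ z                        ∎
      where
      a = + toℕ x
      b = + toℕ y
      c = + toℕ z
    +-identityˡ : LeftIdentity 0ᶠ _+ᶠ_
    +-identityˡ x = begin
      0ᶠ +ᶠ x                  ≡⟨ cong₂ _+ᶠ_ ⟦+ 0 ⟧ (⟦toℕ⟧ x) ⟨
      ⟦ 0ℤ ⟧ +ᶠ ⟦ + toℕ x ⟧    ≡⟨ ⟦⟧-+ 0ℤ (+ toℕ x) ⟨
      ⟦ 0ℤ ℤ.+ + toℕ x ⟧       ≡⟨ cong ⟦_⟧ (ℤ.+-identityˡ (+ toℕ x)) ⟩
      ⟦ + toℕ x ⟧              ≡⟨ ⟦toℕ⟧ x ⟩
      x                        ∎
    +-inverseˡ : LeftInverse 0ᶠ -ᶠ_ _+ᶠ_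
    +-inverseˡ x = begin
      -ᶠ x +ᶠ x                   ≡⟨ cong (-ᶠ x +ᶠ_) (⟦toℕ⟧ x) ⟨
      -ᶠ x +ᶠ ⟦ + toℕ x ⟧         ≡⟨ ⟦⟧-+ (ℤ.- + toℕ x) (+ toℕ x) ⟨
      ⟦ ℤ.- + toℕ x ℤ.+ + toℕ x ⟧ ≡⟨ cong ⟦_⟧ (ℤ.+-inverseˡ (+ toℕ x)) ⟩
      ⟦ 0ℤ ⟧                      ≡⟨ ⟦+ 0 ⟧ ⟩
      0ᶠ                          ∎

  𝔽-almostCommutativeRing : AlmostCommutativeRing _ _
  𝔽-almostCommutativeRing = fromCommutativeRing 𝔽-commutativeRing

  ⟦⟧-morphism : ℤ.+-*-rawRing -Raw-AlmostCommutative⟶ 𝔽-almostCommutativeRing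
  ⟦⟧-morphism = record
    { ⟦_⟧ = ⟦_⟧ ; +-homo = ⟦⟧-+ ; *-homo = ⟦⟧-* ; -‿homo = ⟦⟧-neg
    ; 0-homo = ⟦+ 0 ⟧ ; 1-homo = ⟦+ 1 ⟧ }

  ⟦_≟_⟧ : ∀ i j → Maybe (⟦ i ⟧ ≡ ⟦ j ⟧)
  ⟦ i ≟ j ⟧ with i ℤ.≟ j
  ... | yes i≡j = just (cong ⟦_⟧ i≡j)
  ... | no _    = nothing

  -- The coefficients are integers, not elements of 𝔽, so that they compute while p is a variable.
  open RingSolver ℤ.+-*-rawRing 𝔽-almostCommutativeRing ⟦⟧-morphism ⟦_≟_⟧ public
    using (solve; _:=_; _:+_; _:*_; _:-_; :-_)
  open CommutativeRing 𝔽-commutativeRing public using (_-_)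

module Proof (p : ℕ) (p-prime : Prime p) where
  open Plane p p-prime
  open Field p p-prime
  open ≡-Reasoning

  private instance
    p≢0 : NonZero p
    p≢0 = prime⇒nonZero p-prime

  open CommutativeRing 𝔽-commutativeRing using
    (ring; zeroˡ; zeroʳ; +-identityʳ; *-identityˡ; *-identityʳ; -‿inverseʳ)
    renaming (*-comm to *ᶠ-comm)
  open Algebra.Properties.Ring ring using (-0#≈0#; -‿involutive) renaming
    (x∙y⁻¹≈ε⇒x≈y to x-y≡0⇒x≡y; +-cancelˡ to +ᶠ-cancelˡ; +-cancelʳ to +ᶠ-cancelʳ)

  x+[y-x]≡y : ∀ x y → x +ᶠ (y - x) ≡ y
  x+[y-x]≡y = solve 2 (λ x y → x :+ (y :- x) := y) refl

  x+y-x≡y : ∀ x y → x +ᶠ y - x ≡ y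
  x+y-x≡y = solve 2 (λ x y → x :+ y :- x := y) refl

  x-y+y≡x : ∀ x y → x - y +ᶠ y ≡ x
  x-y+y≡x = solve 2 (λ x y → x :- y :+ y := x) refl

  -ᶠ-nonzero : ∀ c → c ≢ 0ᶠ → -ᶠ c ≢ 0ᶠ
  -ᶠ-nonzero c c≢0 eq = c≢0 (trans (sym (-‿involutive c)) (trans (cong -ᶠ_ eq) -0#≈0#))

  *ᶠ-cancelʳ : ∀ {c x y} → c ≢ 0ᶠ → x *ᶠ c ≡ y *ᶠ c → x ≡ y
  *ᶠ-cancelʳ {c} {x} {y} c≢0 eq = begin
    x               ≡⟨ undo x ⟩
    d *ᶠ (x *ᶠ c)   ≡⟨ cong (d *ᶠ_) eq ⟩
    d *ᶠ (y *ᶠ c)   ≡⟨ undo y ⟨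
    y               ∎
    where
    d = proj₁ (*ᶠ-inverse c c≢0)
    undo : ∀ x → x ≡ d *ᶠ (x *ᶠ c)
    undo x = begin
      x               ≡⟨ *-identityˡ x ⟨
      1ᶠ *ᶠ x         ≡⟨ cong (_*ᶠ x) (proj₂ (*ᶠ-inverse c c≢0)) ⟨
      d *ᶠ c *ᶠ x     ≡⟨ solve 3 (λ d c x → d :* c :* x := d :* (x :* c)) refl d c x ⟩
      d *ᶠ (x *ᶠ c)   ∎

  -- Determinants and affine coordinate systems.

  det : 𝔽² → 𝔽² → 𝔽
  det (a , b) (c , d) = a *ᶠ d - b *ᶠ c

  frame : 𝔽² → 𝔽² → 𝔽² → 𝔽² → 𝔽²
  frame o v w (x , y) = o +ᵛ x · v +ᵛ y · w

  module _ (o v w : 𝔽²) (det≢0 : det v w ≢ 0ᶠ) where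
    private
      o₁ = proj₁ o
      o₂ = proj₂ o
      v₁ = proj₁ v
      v₂ = proj₂ v
      w₁ = proj₁ w
      w₂ = proj₂ w
      δ = proj₁ (*ᶠ-inverse (det v w) det≢0)
      δ-inverse : ∀ x → δ *ᶠ det v w *ᶠ x ≡ x
      δ-inverse x = trans (cong (_*ᶠ x) (proj₂ (*ᶠ-inverse (det v w) det≢0))) (*-identityˡ x)

    frameAGL : AGL
    frameAGL = record
      { to = record { row₁ = v₁ , w₁ ; row₂ = v₂ , w₂ ; translation = o }
      -- Cramer's rule: `δ` is the inverse of the determinant, the rows form `δ` times the adjugate
      -- matrix, and the translation is minus the inverse matrix applied to `o`.
      ; from = record
        { row₁ = δ *ᶠ w₂ , -ᶠ (δ *ᶠ w₁)
        ; row₂ = -ᶠ (δ *ᶠ v₂) , δ *ᶠ v₁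
        ; translation = δ *ᶠ (w₁ *ᶠ o₂ - w₂ *ᶠ o₁) , δ *ᶠ (v₂ *ᶠ o₁ - v₁ *ᶠ o₂)
        }
      ; inverse =
          (λ {u} → λ { refl → cong₂ _,_
            (trans
              (solve 9 (λ a b v₁ v₂ w₁ w₂ o₁ o₂ δ →
                v₁ :* (δ :* w₂ :* a :+ :- (δ :* w₁) :* b :+ δ :* (w₁ :* o₂ :- w₂ :* o₁))
                :+ w₁ :* (:- (δ :* v₂) :* a :+ δ :* v₁ :* b :+ δ :* (v₂ :* o₁ :- v₁ :* o₂)) :+ o₁
                := δ :* (v₁ :* w₂ :- v₂ :* w₁) :* (a :- o₁) :+ o₁) refl
                (proj₁ u) (proj₂ u) v₁ v₂ w₁ w₂ o₁ o₂ δ)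
              (trans (cong (_+ᶠ o₁) (δ-inverse _)) (x-y+y≡x (proj₁ u) o₁)))
            (trans
              (solve 9 (λ a b v₁ v₂ w₁ w₂ o₁ o₂ δ →
                v₂ :* (δ :* w₂ :* a :+ :- (δ :* w₁) :* b :+ δ :* (w₁ :* o₂ :- w₂ :* o₁))
                :+ w₂ :* (:- (δ :* v₂) :* a :+ δ :* v₁ :* b :+ δ :* (v₂ :* o₁ :- v₁ :* o₂)) :+ o₂
                := δ :* (v₁ :* w₂ :- v₂ :* w₁) :* (b :- o₂) :+ o₂) refl
                (proj₁ u) (proj₂ u) v₁ v₂ w₁ w₂ o₁ o₂ δ)
              (trans (cong (_+ᶠ o₂) (δ-inverse _)) (x-y+y≡x (proj₂ u) o₂))) })
        , (λ {u} → λ { refl → cong₂ _,_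
            (trans
              (solve 9 (λ x y v₁ v₂ w₁ w₂ o₁ o₂ δ →
                δ :* w₂ :* (v₁ :* x :+ w₁ :* y :+ o₁) :+ :- (δ :* w₁) :* (v₂ :* x :+ w₂ :* y :+ o₂)
                :+ δ :* (w₁ :* o₂ :- w₂ :* o₁) := δ :* (v₁ :* w₂ :- v₂ :* w₁) :* x) refl
                (proj₁ u) (proj₂ u) v₁ v₂ w₁ w₂ o₁ o₂ δ)
              (δ-inverse _))
            (trans
              (solve 9 (λ x y v₁ v₂ w₁ w₂ o₁ o₂ δ →
                :- (δ :* v₂) :* (v₁ :* x :+ w₁ :* y :+ o₁) :+ δ :* v₁ :* (v₂ :* x :+ w₂ :* y :+ o₂)
                :+ δ :* (v₂ :* o₁ :- v₁ :* o₂) := δ :* (v₁ :* w₂ :- v₂ :* w₁) :* y) refl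
                (proj₁ u) (proj₂ u) v₁ v₂ w₁ w₂ o₁ o₂ δ)
              (δ-inverse _)) })
      }

    frameAGL-⟦⟧ : ∀ u → AGL.⟦ frameAGL ⟧ u ≡ frame o v w u
    frameAGL-⟦⟧ (x , y) = cong₂ _,_ (reorder v₁ w₁ o₁ x y) (reorder v₂ w₂ o₂ x y)
      where
      reorder : ∀ v w o x y → v *ᶠ x +ᶠ w *ᶠ y +ᶠ o ≡ o +ᶠ x *ᶠ v +ᶠ y *ᶠ w
      reorder = solve 5 (λ v w o x y → v :* x :+ w :* y :+ o := o :+ x :* v :+ y :* w) refl

    coords : 𝔽² → 𝔽²
    coords = AffineMap.apply (AGL.from frameAGL)

    frame-coords : ∀ u → frame o v w (coords u) ≡ u
    frame-coords u = trans (sym (frameAGL-⟦⟧ (coords u))) (proj₁ (AGL.inverse frameAGL) refl)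

    coords-frame : ∀ u → coords (frame o v w u) ≡ u
    coords-frame u = proj₂ (AGL.inverse frameAGL) (sym (frameAGL-⟦⟧ u))

  -- Summation over the field and over the plane.

  points-unique : Unique points
  points-unique = Unique.cartesianProduct⁺ (Unique.allFin⁺ p) (Unique.allFin⁺ p)

  ∈-points : ∀ u → u ∈ points
  ∈-points (x , y) = ∈-cartesianProduct⁺ (∈-allFin x) (∈-allFin y)

  length-allFin : length (allFin p) ≡ p
  length-allFin = length-tabulate id

  ∑ᶠ : (𝔽 → ℕ) → ℕ
  ∑ᶠ = ∑ (allFin p)

  ∑ᶠ-const : ∀ c → ∑ᶠ (λ _ → c) ≡ p * c
  ∑ᶠ-const c = trans (∑-const (allFin p) c) (cong (_* c) length-allFin)

  ∑ᶠ-bijection : (f : 𝔽 → ℕ) (h h⁻¹ : 𝔽 → 𝔽) → (∀ x → h (h⁻¹ x) ≡ x) → (∀ x → h⁻¹ (h x) ≡ x) →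
                 ∑ᶠ (f ∘ h) ≡ ∑ᶠ f
  ∑ᶠ-bijection f h h⁻¹ = ∑-bijection f h h⁻¹ (Unique.allFin⁺ p) ∈-allFin

  ∑ᶠ-affine : (f : 𝔽 → ℕ) (c d : 𝔽) → c ≢ 0ᶠ → ∑ᶠ (λ x → f (d +ᶠ x *ᶠ c)) ≡ ∑ᶠ f
  ∑ᶠ-affine f c d c≢0 = ∑ᶠ-bijection f (λ x → d +ᶠ x *ᶠ c) (λ y → e *ᶠ (y - d))
    (λ y → begin
      d +ᶠ e *ᶠ (y - d) *ᶠ c
        ≡⟨ cong (d +ᶠ_) (solve 3 (λ e z c → e :* z :* c := e :* c :* z) refl e (y - d) c) ⟩
      d +ᶠ e *ᶠ c *ᶠ (y - d)    ≡⟨ cong (λ k → d +ᶠ k *ᶠ (y - d)) ec≡1 ⟩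
      d +ᶠ 1ᶠ *ᶠ (y - d)        ≡⟨ cong (d +ᶠ_) (*-identityˡ _) ⟩
      d +ᶠ (y - d)              ≡⟨ x+[y-x]≡y d y ⟩
      y                         ∎)
    (λ x → begin
      e *ᶠ (d +ᶠ x *ᶠ c - d)
        ≡⟨ solve 4 (λ e x d c → e :* (d :+ x :* c :- d) := e :* c :* x) refl e x d c ⟩
      e *ᶠ c *ᶠ x               ≡⟨ cong (_*ᶠ x) ec≡1 ⟩
      1ᶠ *ᶠ x                   ≡⟨ *-identityˡ x ⟩
      x                         ∎)
    where
    e = proj₁ (*ᶠ-inverse c c≢0)
    ec≡1 = proj₂ (*ᶠ-inverse c c≢0)

  ∑-frame : (f : 𝔽² → ℕ) (o v w : 𝔽²) → det v w ≢ 0ᶠ → ∑ points (f ∘ frame o v w) ≡ ∑ points f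
  ∑-frame f o v w det≢0 = ∑-bijection f (frame o v w) (coords o v w det≢0) points-unique ∈-points
    (frame-coords o v w det≢0) (coords-frame o v w det≢0)

  -- Slopes as normal forms of directions.

  Slope : Set
  Slope = Maybe 𝔽

  -- One representative of each direction, with `nothing` as the vertical one. Equality of
  -- directions thereby becomes decidable propositional equality of slopes.
  dir : Slope → 𝔽²
  dir nothing  = 0ᶠ , 1ᶠ
  dir (just m) = 1ᶠ , m

  dir≢0ᵛ : ∀ s → dir s ≢ 0ᵛ
  dir≢0ᵛ nothing  eq = 1ᶠ≢0ᶠ (cong proj₂ eq)
  dir≢0ᵛ (just m) eq = 1ᶠ≢0ᶠ (cong proj₁ eq)

  -- The representatives are normalised, so a vanishing determinant would either give 1 = 0 or
  -- identify the two slopes.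
  det-dir : ∀ s s′ → s ≢ s′ → det (dir s) (dir s′) ≢ 0ᶠ
  det-dir nothing  nothing   s≢s′ _ = s≢s′ refl
  det-dir nothing  (just m′) _ eq = 1ᶠ≢0ᶠ (begin
    1ᶠ          ≡⟨ *-identityˡ 1ᶠ ⟨
    1ᶠ *ᶠ 1ᶠ    ≡⟨ x-y≡0⇒x≡y _ _ eq ⟨
    0ᶠ *ᶠ m′    ≡⟨ zeroˡ m′ ⟩
    0ᶠ          ∎)
  det-dir (just m) nothing   _ eq = 1ᶠ≢0ᶠ (begin
    1ᶠ          ≡⟨ *-identityˡ 1ᶠ ⟨
    1ᶠ *ᶠ 1ᶠ    ≡⟨ x-y≡0⇒x≡y _ _ eq ⟩
    m *ᶠ 0ᶠ     ≡⟨ *ᶠ-comm m 0ᶠ ⟩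
    0ᶠ *ᶠ m     ≡⟨ zeroˡ m ⟩
    0ᶠ          ∎)
  det-dir (just m) (just m′) s≢s′ eq = s≢s′ (cong just (begin
    m           ≡⟨ *-identityʳ m ⟨
    m *ᶠ 1ᶠ     ≡⟨ x-y≡0⇒x≡y _ _ eq ⟨
    1ᶠ *ᶠ m′    ≡⟨ *-identityˡ m′ ⟩
    m′          ∎))

  ∥⇒det≡0 : ∀ {v w} → v ∥ w → det v w ≡ 0ᶠ
  ∥⇒det≡0 {a , b} (c , _ , refl) =
    trans (cong (_- b *ᶠ (c *ᶠ a)) (solve 3 (λ a b c → a :* (c :* b) := b :* (c :* a)) refl a b c))
          (-‿inverseʳ _)

  dir-injective : ∀ {s s′} → dir s ∥ dir s′ → s ≡ s′
  dir-injective {s} {s′} s∥s′ with Maybe.≡-dec _≟_ s s′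
  ... | yes s≡s′ = s≡s′
  ... | no  s≢s′ = contradiction (∥⇒det≡0 s∥s′) (det-dir s s′ s≢s′)

  ∥-dir : ∀ v → v ≢ 0ᵛ → ∃ λ s → v ∥ dir s
  ∥-dir (a , b) v≢0 with a ≟ 0ᶠ
  ... | no a≢0 = just (c *ᶠ b) , c , c≢0 , cong (_, c *ᶠ b) (sym ca≡1)
    where
    c = proj₁ (*ᶠ-inverse a a≢0)
    ca≡1 = proj₂ (*ᶠ-inverse a a≢0)
    c≢0 : c ≢ 0ᶠ
    c≢0 c≡0 = 1ᶠ≢0ᶠ (trans (sym ca≡1) (trans (cong (_*ᶠ a) c≡0) (zeroˡ a)))
  ... | yes refl = nothing , c , c≢0 , cong₂ _,_ (sym (trans (*ᶠ-comm c 0ᶠ) (zeroˡ c))) (sym cb≡1)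
    where
    b≢0 : b ≢ 0ᶠ
    b≢0 b≡0 = v≢0 (cong (0ᶠ ,_) b≡0)
    c = proj₁ (*ᶠ-inverse b b≢0)
    cb≡1 = proj₂ (*ᶠ-inverse b b≢0)
    c≢0 : c ≢ 0ᶠ
    c≢0 c≡0 = 1ᶠ≢0ᶠ (trans (sym cb≡1) (trans (cong (_*ᶠ b) c≡0) (zeroˡ b)))

  slopes : List Slope
  slopes = nothing ∷ map just (allFin p)

  slopes-unique : Unique slopes
  slopes-unique = All.map⁺ (All.tabulate (λ _ ())) ∷
    Unique.map⁺ Maybe.just-injective (Unique.allFin⁺ p)

  ∈-slopes : ∀ s → s ∈ slopes
  ∈-slopes nothing  = here refl
  ∈-slopes (just m) = there (∈-map⁺ just (∈-allFin m))

  length-slopes : length slopes ≡ suc p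
  length-slopes = cong suc (trans (length-map just (allFin p)) length-allFin)

  -- Sums of a function along lines, and double counting.

  module LineSums (g : 𝔽² → ℕ) where

    lineSum : 𝔽² → 𝔽² → ℕ
    lineSum u v = ∑ᶠ (λ t → g (u +ᵛ t · v))

    total : ℕ
    total = ∑ points g

    -- The frame with axes `v` and `w` is a bijection, so these parallel lines partition the plane.
    lineSum-parallel : ∀ o v w → det v w ≢ 0ᶠ → ∑ᶠ (λ z → lineSum (o +ᵛ z · v) w) ≡ total
    lineSum-parallel o v w det≢0 = trans (sym (∑-cartesianProduct _ (allFin p) (allFin p)))
      (∑-frame g o v w det≢0)

    -- Moving the base point along its own line only translates the parameter.
    lineSum-shift : ∀ u s v → lineSum (u +ᵛ s · v) v ≡ lineSum u v
    lineSum-shift u s v = trans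
      (∑-cong (allFin p) (λ t → cong g (cong₂ _,_
        (collect (proj₁ u) s (proj₁ v) t) (collect (proj₂ u) s (proj₂ v) t))))
      (∑ᶠ-bijection (λ t → g (u +ᵛ t · v)) (s +ᶠ_) (_- s) (x+[y-x]≡y s) (x+y-x≡y s))
      where
      collect : ∀ u s v t → u +ᶠ s *ᶠ v +ᶠ t *ᶠ v ≡ u +ᶠ (s +ᶠ t) *ᶠ v
      collect = solve 4 (λ u s v t → u :+ s :* v :+ t :* v := u :+ (s :+ t) :* v) refl

    private
      nonzero : List 𝔽
      nonzero = filter (λ t → ¬? (t ≟ 0ᶠ)) (allFin p)

      allFin-↭ : 0ᶠ ∷ nonzero ↭ allFin p
      allFin-↭ = unique-↭
        (All.tabulate (λ t∈ 0≡t → proj₂ (∈-filter⁻ _ {xs = allFin p} t∈) (sym 0≡t)) ∷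
          Unique.filter⁺ _ (Unique.allFin⁺ p))
        (Unique.allFin⁺ p) (λ {t} → mk⇔ (λ _ → ∈-allFin t) (λ _ → member t))
        where
        member : ∀ t → t ∈ 0ᶠ ∷ nonzero
        member t with t ≟ 0ᶠ
        ... | yes t≡0 = here t≡0
        ... | no  t≢0 = there (∈-filter⁺ _ (∈-allFin t) t≢0)

    -- Points are sorted by their horizontal offset `t` from `u`. For `t ≠ 0` the non-vertical lines
    -- through `u` meet the column at offset `t` in each of its points exactly once. For `t = 0`
    -- each of these `p` lines contributes `u` itself, while the vertical line supplies the missing
    -- column.
    lineSum-slopes : ∀ u → ∑ slopes (λ s → lineSum u (dir s)) ≡ total + p * g u
    lineSum-slopes u@(a , b) = begin
      lineSum u (dir nothing) + ∑ (map just (allFin p)) (λ s → lineSum u (dir s))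
        ≡⟨ cong₂ _+_ vertical (trans (∑-map _ just (allFin p)) (∑-swap _ (allFin p) (allFin p))) ⟩
      column 0ᶠ + ∑ᶠ steps
        ≡⟨ cong (column 0ᶠ +_) (∑-↭ steps allFin-↭) ⟨
      column 0ᶠ + (steps 0ᶠ + ∑ nonzero steps)
        ≡⟨ cong (column 0ᶠ +_) (cong₂ _+_ centre (∑-cong∈ nonzero
             (λ t∈ → off-centre (proj₂ (∈-filter⁻ _ {xs = allFin p} t∈))))) ⟩
      column 0ᶠ + (p * g u + ∑ nonzero column)
        ≡⟨ rotate (column 0ᶠ) (p * g u) _ ⟩
      ∑ (0ᶠ ∷ nonzero) column + p * g u
        ≡⟨ cong (_+ p * g u) (∑-↭ column allFin-↭) ⟩
      ∑ᶠ column + p * g u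
        ≡⟨ cong (_+ p * g u) whole ⟩
      total + p * g u ∎
      where
      column steps : 𝔽 → ℕ
      column t = ∑ᶠ (λ y → g (a +ᶠ t , b +ᶠ y))
      steps t = ∑ᶠ (λ m → g (u +ᵛ t · dir (just m)))
      rotate : ∀ x y z → x + (y + z) ≡ x + z + y
      rotate = solve-∀
      vertical : lineSum u (dir nothing) ≡ column 0ᶠ
      vertical = ∑-cong (allFin p) (λ t → cong g (cong₂ _,_
        (cong (a +ᶠ_) (zeroʳ t)) (cong (b +ᶠ_) (*-identityʳ t))))
      centre : steps 0ᶠ ≡ p * g u
      centre = trans
        (∑-cong (allFin p) (λ m → cong g (cong₂ _,_ (absorb a 1ᶠ) (absorb b m))))
        (∑ᶠ-const (g u))
        where
        absorb : ∀ a x → a +ᶠ 0ᶠ *ᶠ x ≡ a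
        absorb a x = trans (cong (a +ᶠ_) (zeroˡ x)) (+-identityʳ a)
      off-centre : ∀ {t} → t ≢ 0ᶠ → steps t ≡ column t
      off-centre {t} t≢0 = trans
        (∑-cong (allFin p) (λ m → cong g (cong₂ _,_
          (cong (a +ᶠ_) (*-identityʳ t)) (cong (b +ᶠ_) (*ᶠ-comm t m)))))
        (trans (∑ᶠ-affine (λ y → g (a +ᶠ t , y)) t b t≢0)
          (sym (∑ᶠ-bijection (λ y → g (a +ᶠ t , y)) (b +ᶠ_) (_- b) (x+[y-x]≡y b) (x+y-x≡y b))))
      whole : ∑ᶠ column ≡ total
      whole = trans (sym (∑-cartesianProduct _ (allFin p) (allFin p)))
        (∑-bijection g (u +ᵛ_) (λ (x , y) → x - a , y - b) points-unique ∈-points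
          (λ (x , y) → cong₂ _,_ (x+[y-x]≡y a x) (x+[y-x]≡y b y))
          (λ (x , y) → cong₂ _,_ (x+y-x≡y a x) (x+y-x≡y b y)))

  module _ {T : Pred 𝔽² 0ℓ} (T? : Decidable T) where
    open LineSums (𝟙 ∘ T?)

    card-total : card T? ≡ total
    card-total = length-filter T? points

    -- Since `v` is nonzero, `t ↦ u + t v` is injective, and points of `T` on the line correspond to
    -- parameters. This replaces the geometric count in the definition of equidistribution by a sum.
    card-line : ∀ u v → v ≢ 0ᵛ → card (T? ∩? line? u v) ≡ lineSum u v
    card-line u v v≢0 = begin
      length (filter (T? ∩? line? u v) points)      ≡⟨ ↭-length line-↭ ⟨
      length (map h (filter (T? ∘ h) (allFin p)))   ≡⟨ length-map h (filter (T? ∘ h) (allFin p)) ⟩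
      length (filter (T? ∘ h) (allFin p))           ≡⟨ length-filter (T? ∘ h) (allFin p) ⟩
      lineSum u v                                   ∎
      where
      h : 𝔽 → 𝔽²
      h t = u +ᵛ t · v
      h-injective : ∀ {s t} → h s ≡ h t → s ≡ t
      h-injective {s} {t} eq with proj₁ v ≟ 0ᶠ
      ... | no  a≢0 = *ᶠ-cancelʳ a≢0 (+ᶠ-cancelˡ _ _ _ (cong proj₁ eq))
      ... | yes a≡0 = *ᶠ-cancelʳ (λ b≡0 → v≢0 (cong₂ _,_ a≡0 b≡0))
                        (+ᶠ-cancelˡ _ _ _ (cong proj₂ eq))
      line-↭ : map h (filter (T? ∘ h) (allFin p)) ↭ filter (T? ∩? line? u v) points
      line-↭ = map-↭ h
        (Unique.filter⁺ (T? ∘ h) (Unique.allFin⁺ p))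
        (Unique.filter⁺ (T? ∩? line? u v) points-unique) h-injective
        (λ {t} t∈ → ∈-filter⁺ (T? ∩? line? u v) (∈-points (h t))
                      (proj₂ (∈-filter⁻ (T? ∘ h) {xs = allFin p} t∈) , t , refl))
        (λ w∈ → let Tw , t , w≡ht = proj₂ (∈-filter⁻ (T? ∩? line? u v) {xs = points} w∈) in
                t , ∈-filter⁺ (T? ∘ h) (∈-allFin t) (subst T w≡ht Tw) , w≡ht)

  -- Natural numbers and their residues modulo p.

  ι : ℕ → 𝔽
  ι n = n ℕ.mod p

  ι-+ : ∀ m n → ι (m + n) ≡ ι m +ᶠ ι n
  ι-+ m n = trans (sym ⟦+ m + n ⟧) (trans (⟦⟧-+ (ℤ.+ m) (ℤ.+ n)) (cong₂ _+ᶠ_ ⟦+ m ⟧ ⟦+ n ⟧))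

  ι-+-multiple : ∀ m k → ι (m + p * k) ≡ ι m
  ι-+-multiple m k = mod-cong
    (trans (cong (λ j → (m + j) % p) (ℕ.*-comm p k)) (ℕ.[m+kn]%n≡m%n m k p))

  ι-toℕ : ∀ x → ι (toℕ x) ≡ x
  ι-toℕ x = toℕ-injective (trans (toℕ-mod (toℕ x)) (toℕ-% x))

  ι[p]≡0 : ι p ≡ 0ᶠ
  ι[p]≡0 = mod-cong (trans (ℕ.n%n≡0 p) (sym (ℕ.m<n⇒m%n≡m (ℕ.>-nonZero⁻¹ p))))

  p-1+1≡p : 1 + (p ∸ 1) ≡ p
  p-1+1≡p = ℕ.m+[n∸m]≡n (ℕ.>-nonZero⁻¹ p)

  ι[p-1]≢0 : ι (p ∸ 1) ≢ 0ᶠ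
  ι[p-1]≢0 eq = 1ᶠ≢0ᶠ (begin
    1ᶠ                 ≡⟨ +-identityʳ 1ᶠ ⟨
    1ᶠ +ᶠ 0ᶠ           ≡⟨ cong (1ᶠ +ᶠ_) eq ⟨
    1ᶠ +ᶠ ι (p ∸ 1)    ≡⟨ ι-+ 1 (p ∸ 1) ⟨
    ι (1 + (p ∸ 1))    ≡⟨ cong ι p-1+1≡p ⟩
    ι p                ≡⟨ ι[p]≡0 ⟩
    0ᶠ                 ∎)

  -- The field element `ι (p ∸ 1)` is -1, and -1 - x is represented by p - 1 - x without wrapping
  -- around; it is the library's `opposite x`.
  toℕ-reflect : ∀ x → toℕ (ι (p ∸ 1) - x) + toℕ x ≡ p ∸ 1
  toℕ-reflect x = subst (λ y → toℕ y + toℕ x ≡ p ∸ 1) opposite≡ sum≡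
    where
    sum≡ : toℕ (opposite x) + toℕ x ≡ p ∸ 1
    sum≡ = ℕ.suc-injective (begin
      suc (toℕ (opposite x) + toℕ x)    ≡⟨ ℕ.+-suc (toℕ (opposite x)) (toℕ x) ⟨
      toℕ (opposite x) + suc (toℕ x)    ≡⟨ cong (_+ suc (toℕ x)) (opposite-prop x) ⟩
      p ∸ suc (toℕ x) + suc (toℕ x)     ≡⟨ ℕ.m∸n+n≡m (toℕ<n x) ⟩
      p                                 ≡⟨ p-1+1≡p ⟨
      suc (p ∸ 1)                       ∎)
    opposite≡ : opposite x ≡ ι (p ∸ 1) - x
    opposite≡ = +ᶠ-cancelʳ x _ _ (begin
      opposite x +ᶠ x                        ≡⟨ cong ι sum≡ ⟩
      ι (p ∸ 1)                              ≡⟨ x-y+y≡x (ι (p ∸ 1)) x ⟨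
      ι (p ∸ 1) - x +ᶠ x                     ∎)

  -- Every number is at least its residue. With nonzero slope the residues are a permutation of 0,
  -- ..., p - 1, so they already add up to the total of `A`, and no entry can exceed its residue.
  affine-residue : ∀ (A : 𝔽 → ℕ) d {c} → c ≢ 0ᶠ → (∀ x → ι (A x) ≡ d +ᶠ x *ᶠ c) →
                   2 * ∑ᶠ A ≡ p * (p ∸ 1) → ∀ x → A x ≡ toℕ (d +ᶠ x *ᶠ c)
  affine-residue A d {c} c≢0 A≡ half x = sym (∑-≤-≡ residue≤ (allFin p) sums≡ (∈-allFin x))
    where
    residue≤ : ∀ x → toℕ (d +ᶠ x *ᶠ c) ≤ A x
    residue≤ x = subst (_≤ A x) (trans (sym (toℕ-mod (A x))) (cong toℕ (A≡ x))) (ℕ.m%n≤m (A x) p)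
    sums≡ : ∑ᶠ (λ x → toℕ (d +ᶠ x *ᶠ c)) ≡ ∑ᶠ A
    sums≡ = trans (∑ᶠ-affine toℕ c d c≢0) (ℕ.*-cancelˡ-≡ _ _ 2 (trans (2∑toℕ p) (sym half)))

  -- Among 0, ..., p only 0 and p share a residue. A nonzero common residue would therefore
  -- determine the value and make `A` constant.
  constant-residue : (A : 𝔽 → ℕ) {r : 𝔽} → (∀ x → A x ≤ p) → (∀ x → ι (A x) ≡ r) →
                     ¬ (∀ x y → A x ≡ A y) → r ≡ 0ᶠ
  constant-residue A {r} A≤p A≡r nonconstant with r ≟ 0ᶠ
  ... | yes r≡0 = r≡0
  ... | no  r≢0 = contradiction (λ x y → trans (value x) (sym (value y))) nonconstant
    where
    value : ∀ x → A x ≡ toℕ r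
    value x with ℕ.m≤n⇒m<n∨m≡n (A≤p x)
    ... | inj₁ A<p =
      trans (sym (ℕ.m<n⇒m%n≡m A<p)) (trans (sym (toℕ-mod (A x))) (cong toℕ (A≡r x)))
    ... | inj₂ A≡p = contradiction (trans (sym (A≡r x)) (trans (cong ι A≡p) ι[p]≡0)) r≢0

  -- The element 1 generates the additive group, so the steps from 0 reach every `y`; the induction
  -- runs over its natural representative.
  arithmetic-progression : (a : 𝔽 → 𝔽) (c : 𝔽) → (∀ y → a (1ᶠ +ᶠ y) ≡ a y +ᶠ c) →
                           ∀ y → a y ≡ a 0ᶠ +ᶠ y *ᶠ c
  arithmetic-progression a c step y = subst (λ y → a y ≡ a 0ᶠ +ᶠ y *ᶠ c) (ι-toℕ y) (go (toℕ y))
    where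
    go : ∀ n → a (ι n) ≡ a 0ᶠ +ᶠ ι n *ᶠ c
    go zero = sym (trans (cong (a 0ᶠ +ᶠ_) (*ᶠ-zeroˡ c)) (+-identityʳ (a 0ᶠ)))
    go (suc n) = begin
      a (ι (suc n))                      ≡⟨ cong a (ι-+ 1 n) ⟩
      a (1ᶠ +ᶠ ι n)                      ≡⟨ step (ι n) ⟩
      a (ι n) +ᶠ c                       ≡⟨ cong (_+ᶠ c) (go n) ⟩
      a 0ᶠ +ᶠ ι n *ᶠ c +ᶠ c              ≡⟨ cong (a 0ᶠ +ᶠ ι n *ᶠ c +ᶠ_) (*ᶠ-identityˡ c) ⟨
      a 0ᶠ +ᶠ ι n *ᶠ c +ᶠ 1ᶠ *ᶠ c
        ≡⟨ solve 4 (λ a n c o → a :+ n :* c :+ o :* c := a :+ (o :+ n) :* c) refl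
             (a 0ᶠ) (ι n) c 1ᶠ ⟩
      a 0ᶠ +ᶠ (1ᶠ +ᶠ ι n) *ᶠ c           ≡⟨ cong (λ m → a 0ᶠ +ᶠ m *ᶠ c) (ι-+ 1 n) ⟨
      a 0ᶠ +ᶠ ι (suc n) *ᶠ c             ∎

  -- Three profiles in balance: affine modulo p, then exactly determined.

  module _
    (A B C : 𝔽 → ℕ) (h : 𝔽 → 𝔽 → ℕ)
    (balance : ∀ x y → A y + B x + C (x - y) ≡ p ∸ 1 + p * h x y)
    where
    private
      a b c : 𝔽 → 𝔽
      a = ι ∘ A
      b = ι ∘ B
      c = ι ∘ C
      ε κ : 𝔽
      ε = ι (p ∸ 1)
      κ = c 1ᶠ - c 0ᶠ

      balanceᶠ : ∀ x y → a y +ᶠ b x +ᶠ c (x - y) ≡ ε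
      balanceᶠ x y = begin
        a y +ᶠ b x +ᶠ c (x - y)         ≡⟨ cong (_+ᶠ c (x - y)) (ι-+ (A y) (B x)) ⟨
        ι (A y + B x) +ᶠ c (x - y)      ≡⟨ ι-+ (A y + B x) (C (x - y)) ⟨
        ι (A y + B x + C (x - y))       ≡⟨ cong ι (balance x y) ⟩
        ι (p ∸ 1 + p * h x y)           ≡⟨ ι-+-multiple (p ∸ 1) (h x y) ⟩
        ε                               ∎

      c-at : ∀ {z} x y → x - y ≡ z → c z ≡ ε - a y - b x
      c-at x y refl = trans
        (solve 3 (λ a b c → c := a :+ b :+ c :- a :- b) refl (a y) (b x) (c (x - y)))
        (cong (λ e → e - a y - b x) (balanceᶠ x y))

      c₀ : ∀ y → c 0ᶠ ≡ ε - a y - b y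
      c₀ y = c-at y y (-‿inverseʳ y)

      -- The balance at `(1 + y , y)` and at `(1 + y , 1 + y)` involves the same value of `b`. Their
      -- difference shows that `a` grows by `c 1 - c 0 = κ` at each step.
      a-affine : ∀ y → a y ≡ a 0ᶠ +ᶠ y *ᶠ κ
      a-affine = arithmetic-progression a κ λ y → begin
        a (1ᶠ +ᶠ y)
          ≡⟨ solve 4 (λ a a′ b e → a := a′ :+ ((e :- a′ :- b) :- (e :- a :- b))) refl
               (a (1ᶠ +ᶠ y)) (a y) (b (1ᶠ +ᶠ y)) ε ⟩
        a y +ᶠ (ε - a y - b (1ᶠ +ᶠ y) - (ε - a (1ᶠ +ᶠ y) - b (1ᶠ +ᶠ y)))
          ≡⟨ cong₂ (λ c₁ c₀ → a y +ᶠ (c₁ - c₀)) (c-at (1ᶠ +ᶠ y) y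
               (solve 2 (λ o y → o :+ y :- y := o) refl 1ᶠ y)) (c₀ (1ᶠ +ᶠ y)) ⟨
        a y +ᶠ κ ∎

      -- On the diagonal the argument of `c` is 0, so `a + b` is constant there and `b` has the
      -- opposite slope.
      b-affine : ∀ x → b x ≡ b 0ᶠ +ᶠ x *ᶠ (-ᶠ κ)
      b-affine x = begin
        b x
          ≡⟨ solve 3 (λ a b e → b := e :- a :- (e :- a :- b)) refl (a x) (b x) ε ⟩
        ε - a x - (ε - a x - b x)
          ≡⟨ cong₂ (λ a c → ε - a - c) (a-affine x) (trans (sym (c₀ x)) (c₀ 0ᶠ)) ⟩
        ε - (a 0ᶠ +ᶠ x *ᶠ κ) - (ε - a 0ᶠ - b 0ᶠ)
          ≡⟨ solve 5 (λ e a x k b → e :- (a :+ x :* k) :- (e :- a :- b) := b :+ x :* (:- k)) refl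
               ε (a 0ᶠ) x κ (b 0ᶠ) ⟩
        b 0ᶠ +ᶠ x *ᶠ (-ᶠ κ) ∎

      -- On the axis `y = 0` the balance expresses `c` through `b` alone.
      c-affine : ∀ z → c z ≡ c 0ᶠ +ᶠ z *ᶠ κ
      c-affine z = begin
        c z
          ≡⟨ c-at z 0ᶠ (trans (cong (z +ᶠ_) -0#≈0#) (+-identityʳ z)) ⟩
        ε - a 0ᶠ - b z
          ≡⟨ cong (ε - a 0ᶠ -_) (b-affine z) ⟩
        ε - a 0ᶠ - (b 0ᶠ +ᶠ z *ᶠ (-ᶠ κ))
          ≡⟨ solve 5 (λ e a b z k → e :- a :- (b :+ z :* (:- k)) := e :- a :- b :+ z :* k) refl
               ε (a 0ᶠ) (b 0ᶠ) z κ ⟩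
        ε - a 0ᶠ - b 0ᶠ +ᶠ z *ᶠ κ
          ≡⟨ cong (_+ᶠ z *ᶠ κ) (c₀ 0ᶠ) ⟨
        c 0ᶠ +ᶠ z *ᶠ κ ∎

    module _
      (A≤p : ∀ y → A y ≤ p) (B≤p : ∀ x → B x ≤ p) (C≤p : ∀ z → C z ≤ p)
      (A-nonconstant : ¬ (∀ x y → A x ≡ A y))
      (B-nonconstant : ¬ (∀ x y → B x ≡ B y))
      (C-nonconstant : ¬ (∀ x y → C x ≡ C y))
      (A-sum : 2 * ∑ᶠ A ≡ p * (p ∸ 1))
      (B-sum : 2 * ∑ᶠ B ≡ p * (p ∸ 1))
      (C-sum : 2 * ∑ᶠ C ≡ p * (p ∸ 1))
      where

      private
        -- If κ = 0, each profile is constant mod p but not constant, so it takes only the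
        -- values 0 and p; this contradicts A + B + C ≡ -1.
        κ≢0 : κ ≢ 0ᶠ
        κ≢0 κ≡0 = ι[p-1]≢0 (begin
          ε                                ≡⟨ balanceᶠ 0ᶠ 0ᶠ ⟨
          a 0ᶠ +ᶠ b 0ᶠ +ᶠ c (0ᶠ - 0ᶠ)      ≡⟨ cong₂ _+ᶠ_ (cong₂ _+ᶠ_ a≡0 b≡0) c≡0 ⟩
          0ᶠ +ᶠ 0ᶠ +ᶠ 0ᶠ                   ≡⟨ trans (+-identityʳ _) (+-identityʳ 0ᶠ) ⟩
          0ᶠ                               ∎)
          where
          -κ≡0 : -ᶠ κ ≡ 0ᶠ
          -κ≡0 = trans (cong -ᶠ_ κ≡0) -0#≈0#
          drop : ∀ {k} d x → k ≡ 0ᶠ → d +ᶠ x *ᶠ k ≡ d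
          drop d x refl = trans (cong (d +ᶠ_) (zeroʳ x)) (+-identityʳ d)
          a≡0 = constant-residue A A≤p (λ y → trans (a-affine y) (drop (a 0ᶠ) y κ≡0)) A-nonconstant
          b≡0 = constant-residue B B≤p (λ x → trans (b-affine x) (drop (b 0ᶠ) x -κ≡0)) B-nonconstant
          c≡c₀ : ∀ z → c z ≡ c 0ᶠ
          c≡c₀ z = trans (c-affine z) (drop (c 0ᶠ) z κ≡0)
          c≡0 : c (0ᶠ - 0ᶠ) ≡ 0ᶠ
          c≡0 = trans (c≡c₀ (0ᶠ - 0ᶠ)) (constant-residue C C≤p c≡c₀ C-nonconstant)

        -κ≢0 : -ᶠ κ ≢ 0ᶠ
        -κ≢0 = -ᶠ-nonzero κ κ≢0

        -- `C` coincides with its residues, which excludes the value `p`. The overflow argument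
        -- needs the bound `p ∸ 1`; the a priori bound `p` would be one too large.
        C<p : ∀ z → C z < p
        C<p z = subst (_< p) (sym (affine-residue C (c 0ᶠ) κ≢0 c-affine C-sum z)) (toℕ<n _)

      -- `A` and `B` equal their affine residues, and -1 - A has representative p - 1 - A. The
      -- comparison thus says A + B ≥ p, which the balance decides according to whether `h` is 1 or
      -- 0.
      staircase : ∃ λ a₀ → ∃ λ b₀ → ∃ λ k → k ≢ 0ᶠ × ∀ x y →
        (h x y ≡ 1 → toℕ (ι (p ∸ 1) - (a₀ +ᶠ y *ᶠ k)) < toℕ (b₀ +ᶠ x *ᶠ (-ᶠ k))) ×
        (h x y ≡ 0 → ¬ toℕ (ι (p ∸ 1) - (a₀ +ᶠ y *ᶠ k)) < toℕ (b₀ +ᶠ x *ᶠ (-ᶠ k)))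
      staircase = a 0ᶠ , b 0ᶠ , κ , κ≢0 , λ x y → above x y , below x y
        where
        Y : 𝔽 → ℕ
        Y y = toℕ (ε - (a 0ᶠ +ᶠ y *ᶠ κ))
        Y+A : ∀ y → Y y + A y ≡ p ∸ 1
        Y+A y = trans (cong (λ n → Y y + n) (affine-residue A (a 0ᶠ) κ≢0 a-affine A-sum y))
          (toℕ-reflect (a 0ᶠ +ᶠ y *ᶠ κ))
        B≡ : ∀ x → B x ≡ toℕ (b 0ᶠ +ᶠ x *ᶠ (-ᶠ κ))
        B≡ = affine-residue B (b 0ᶠ) -κ≢0 b-affine B-sum
        above : ∀ x y → h x y ≡ 1 → Y y < toℕ (b 0ᶠ +ᶠ x *ᶠ (-ᶠ κ))
        above x y h≡1 = subst (Y y <_) (B≡ x) (overflow⇒< (Y+A y) C≤p-1 (begin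
          A y + B x + C (x - y)     ≡⟨ balance x y ⟩
          p ∸ 1 + p * h x y         ≡⟨ cong (λ n → p ∸ 1 + p * n) h≡1 ⟩
          p ∸ 1 + p * 1             ≡⟨ cong (λ n → p ∸ 1 + n) (ℕ.*-identityʳ p) ⟩
          p ∸ 1 + p                 ≡⟨ cong (λ n → p ∸ 1 + n) p-1+1≡p ⟨
          p ∸ 1 + (1 + (p ∸ 1))     ∎))
          where
          C≤p-1 : C (x - y) ≤ p ∸ 1
          C≤p-1 = ℕ.s≤s⁻¹ (subst (C (x - y) <_) (sym p-1+1≡p) (C<p (x - y)))
        below : ∀ x y → h x y ≡ 0 → ¬ Y y < toℕ (b 0ᶠ +ᶠ x *ᶠ (-ᶠ κ))
        below x y h≡0 = subst (λ n → ¬ Y y < n) (B≡ x) (no-overflow⇒≮ (Y+A y) (begin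
          A y + B x + C (x - y)     ≡⟨ balance x y ⟩
          p ∸ 1 + p * h x y         ≡⟨ cong (λ n → p ∸ 1 + p * n) h≡0 ⟩
          p ∸ 1 + p * 0             ≡⟨ cong (λ n → p ∸ 1 + n) (ℕ.*-zeroʳ p) ⟩
          p ∸ 1 + 0                 ≡⟨ ℕ.+-identityʳ (p ∸ 1) ⟩
          p ∸ 1                     ∎))

  -- Recovering the set from three special directions.

  det-scaleˡ : ∀ c v w → c ≢ 0ᶠ → det v w ≢ 0ᶠ → det (c · v) w ≢ 0ᶠ
  det-scaleˡ c (a , b) (a′ , b′) c≢0 det≢0 eq = *ᶠ-nonzero c≢0 det≢0 (trans
    (solve 5 (λ c a b a′ b′ → c :* (a :* b′ :- b :* a′) := c :* a :* b′ :- c :* b :* a′) refl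
      c a b a′ b′) eq)

  det-swap : ∀ v w → det v w ≢ 0ᶠ → det w v ≢ 0ᶠ
  det-swap (a , b) (a′ , b′) det≢0 eq = det≢0 (begin
    a *ᶠ b′ - b *ᶠ a′
      ≡⟨ solve 4 (λ a b a′ b′ → a :* b′ :- b :* a′ := :- (a′ :* b :- b′ :* a)) refl a b a′ b′ ⟩
    -ᶠ (a′ *ᶠ b - b′ *ᶠ a)     ≡⟨ cong -ᶠ_ eq ⟩
    -ᶠ 0ᶠ                      ≡⟨ -0#≈0# ⟩
    0ᶠ                         ∎)

  module _ {T : Pred 𝔽² 0ℓ} (T? : Decidable T) where
    open LineSums (𝟙 ∘ T?)

    lineSum≤p : ∀ u v → lineSum u v ≤ p
    lineSum≤p u v = ℕ.≤-trans (∑-mono (λ t → 𝟙≤1 (T? _)) (allFin p))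
      (ℕ.≤-reflexive (trans (∑ᶠ-const 1) (ℕ.*-identityʳ p)))
      where
      𝟙≤1 : ∀ {P : Set} (P? : Dec P) → 𝟙 P? ≤ 1
      𝟙≤1 (yes _) = s≤s z≤n
      𝟙≤1 (no _)  = z≤n

    -- Every line parallel to `w` meets the transversal `o + z v`, so a profile constant along that
    -- transversal would make the line sums constant everywhere.
    nonconstant-profile : ∀ o v w → det v w ≢ 0ᶠ → ¬ (∀ u u′ → lineSum u w ≡ lineSum u′ w) →
                          ¬ (∀ z z′ → lineSum (o +ᵛ z · v) w ≡ lineSum (o +ᵛ z′ · v) w)
    nonconstant-profile o v w det≢0 nonconstant constant =
      nonconstant (λ u u′ → trans (reduce u) (trans (constant (z u) (z u′)) (sym (reduce u′))))
      where
      z t : 𝔽² → 𝔽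
      z u = proj₁ (coords o v w det≢0 u)
      t u = proj₂ (coords o v w det≢0 u)
      reduce : ∀ u → lineSum u w ≡ lineSum (o +ᵛ z u · v) w
      reduce u = trans (cong (λ u → lineSum u w) (sym (frame-coords o v w det≢0 u)))
        (lineSum-shift (o +ᵛ z u · v) (t u) w)

    -- Rescaling `v₁` and `v₂` so that their sum points along `v₃` gives coordinates in which the
    -- three line sums depend on `y`, `x` and `x - y` respectively. The staircase description of `T`
    -- in these coordinates is then transported back to the plane.
    three-directions : ∀ v₁ v₂ v₃ → det v₁ v₂ ≢ 0ᶠ → det v₃ v₂ ≢ 0ᶠ → det v₁ v₃ ≢ 0ᶠ →
      ¬ (∀ u u′ → lineSum u v₁ ≡ lineSum u′ v₁) →
      ¬ (∀ u u′ → lineSum u v₂ ≡ lineSum u′ v₂) →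
      ¬ (∀ u u′ → lineSum u v₃ ≡ lineSum u′ v₃) →
      (∀ u → lineSum u v₁ + lineSum u v₂ + lineSum u v₃ ≡ p ∸ 1 + p * 𝟙 (T? u)) →
      2 * total ≡ p * (p ∸ 1) → ∃ λ α → T ≐ image α S
    three-directions v₁ v₂ v₃ det₁₂ det₃₂ det₁₃ special₁ special₂ special₃ balance half =
      α , T⊆ , ⊆T
      where
      o w₁ w₂ : 𝔽²
      o = 0ᵛ
      -- By Cramer's rule w₁ + w₂ is the multiple det v₁ v₂ · v₃ of v₃.
      w₁ = det v₃ v₂ · v₁
      w₂ = det v₁ v₃ · v₂

      A B C : 𝔽 → ℕ
      A y = lineSum (o +ᵛ y · w₂) v₁
      B x = lineSum (o +ᵛ x · w₁) v₂
      C z = lineSum (o +ᵛ z · w₁) v₃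

      pt : 𝔽² → 𝔽²
      pt = frame o w₁ w₂

      pt₁ : ∀ x y → lineSum (pt (x , y)) v₁ ≡ A y
      pt₁ x y = trans
        (cong (λ u → lineSum u v₁) (cong₂ _,_ (slide (proj₁ o) (proj₁ v₁) (proj₁ w₂))
                                              (slide (proj₂ o) (proj₂ v₁) (proj₂ w₂))))
        (lineSum-shift (o +ᵛ y · w₂) (x *ᶠ det v₃ v₂) v₁)
        where
        slide : ∀ o v w → o +ᶠ x *ᶠ (det v₃ v₂ *ᶠ v) +ᶠ y *ᶠ w ≡ o +ᶠ y *ᶠ w +ᶠ x *ᶠ det v₃ v₂ *ᶠ v
        slide o v w = solve 6
          (λ x d y o v w → o :+ x :* (d :* v) :+ y :* w := o :+ y :* w :+ x :* d :* v) refl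
          x (det v₃ v₂) y o v w

      pt₂ : ∀ x y → lineSum (pt (x , y)) v₂ ≡ B x
      pt₂ x y = trans
        (cong (λ u → lineSum u v₂) (cong₂ _,_ (slide (proj₁ o) (proj₁ v₂) (proj₁ w₁))
                                              (slide (proj₂ o) (proj₂ v₂) (proj₂ w₁))))
        (lineSum-shift (o +ᵛ x · w₁) (y *ᶠ det v₁ v₃) v₂)
        where
        slide : ∀ o v w → o +ᶠ x *ᶠ w +ᶠ y *ᶠ (det v₁ v₃ *ᶠ v) ≡ o +ᶠ x *ᶠ w +ᶠ y *ᶠ det v₁ v₃ *ᶠ v
        slide o v w = cong (o +ᶠ x *ᶠ w +ᶠ_) (sym (*ᶠ-assoc y (det v₁ v₃) v))

      -- This is x w₁ + y w₂ = (x - y) w₁ + y (w₁ + w₂), where the last summand moves along `v₃`.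
      -- Hence only `x - y` matters for the line in direction `v₃`.
      pt-slide : ∀ x y → pt (x , y) ≡ o +ᵛ (x - y) · w₁ +ᵛ (y *ᶠ det v₁ v₂) · v₃
      pt-slide x y = cong₂ _,_
        (solve 9 (λ x y o v₁ v₁′ v₂ v₂′ v₃ v₃′ →
          o :+ x :* ((v₃ :* v₂′ :- v₃′ :* v₂) :* v₁) :+ y :* ((v₁ :* v₃′ :- v₁′ :* v₃) :* v₂) :=
          o :+ (x :- y) :* ((v₃ :* v₂′ :- v₃′ :* v₂) :* v₁)
            :+ y :* (v₁ :* v₂′ :- v₁′ :* v₂) :* v₃) refl
          x y (proj₁ o) (proj₁ v₁) (proj₂ v₁) (proj₁ v₂) (proj₂ v₂) (proj₁ v₃) (proj₂ v₃))
        (solve 9 (λ x y o v₁ v₁′ v₂ v₂′ v₃ v₃′ →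
          o :+ x :* ((v₃ :* v₂′ :- v₃′ :* v₂) :* v₁′) :+ y :* ((v₁ :* v₃′ :- v₁′ :* v₃) :* v₂′) :=
          o :+ (x :- y) :* ((v₃ :* v₂′ :- v₃′ :* v₂) :* v₁′)
            :+ y :* (v₁ :* v₂′ :- v₁′ :* v₂) :* v₃′) refl
          x y (proj₂ o) (proj₁ v₁) (proj₂ v₁) (proj₁ v₂) (proj₂ v₂) (proj₁ v₃) (proj₂ v₃))

      pt₃ : ∀ x y → lineSum (pt (x , y)) v₃ ≡ C (x - y)
      pt₃ x y = trans (cong (λ u → lineSum u v₃) (pt-slide x y))
        (lineSum-shift (o +ᵛ (x - y) · w₁) (y *ᶠ det v₁ v₂) v₃)

      balance′ : ∀ x y → A y + B x + C (x - y) ≡ p ∸ 1 + p * 𝟙 (T? (pt (x , y)))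
      balance′ x y = trans
        (sym (cong₂ _+_ (cong₂ _+_ (pt₁ x y) (pt₂ x y)) (pt₃ x y))) (balance (pt (x , y)))

      det-w₂v₁ : det w₂ v₁ ≢ 0ᶠ
      det-w₂v₁ = det-scaleˡ (det v₁ v₃) v₂ v₁ det₁₃ (det-swap v₁ v₂ det₁₂)
      det-w₁v₂ : det w₁ v₂ ≢ 0ᶠ
      det-w₁v₂ = det-scaleˡ (det v₃ v₂) v₁ v₂ det₃₂ det₁₂
      det-w₁v₃ : det w₁ v₃ ≢ 0ᶠ
      det-w₁v₃ = det-scaleˡ (det v₃ v₂) v₁ v₃ det₃₂ det₁₃
      det-w₁w₂ : det w₁ w₂ ≢ 0ᶠ
      det-w₁w₂ = det-swap w₂ w₁ (det-scaleˡ (det v₁ v₃) v₂ w₁ det₁₃ (det-swap w₁ v₂ det-w₁v₂))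

      profiles = staircase A B C (λ x y → 𝟙 (T? (pt (x , y)))) balance′
        (λ y → lineSum≤p (o +ᵛ y · w₂) v₁)
        (λ x → lineSum≤p (o +ᵛ x · w₁) v₂)
        (λ z → lineSum≤p (o +ᵛ z · w₁) v₃)
        (nonconstant-profile o w₂ v₁ det-w₂v₁ special₁)
        (nonconstant-profile o w₁ v₂ det-w₁v₂ special₂)
        (nonconstant-profile o w₁ v₃ det-w₁v₃ special₃)
        (trans (cong (2 *_) (lineSum-parallel o w₂ v₁ det-w₂v₁)) half)
        (trans (cong (2 *_) (lineSum-parallel o w₁ v₂ det-w₁v₂)) half)
        (trans (cong (2 *_) (lineSum-parallel o w₁ v₃ det-w₁v₃)) half)

      a₀ = proj₁ profiles
      b₀ = proj₁ (proj₂ profiles)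
      k = proj₁ (proj₂ (proj₂ profiles))
      k≢0 = proj₁ (proj₂ (proj₂ (proj₂ profiles)))
      region = proj₂ (proj₂ (proj₂ (proj₂ profiles)))

      ε e : 𝔽
      ε = ι (p ∸ 1)
      e = proj₁ (*ᶠ-inverse k k≢0)
      ek≡1 = proj₂ (*ᶠ-inverse k k≢0)
      -e≢0 : -ᶠ e ≢ 0ᶠ
      -e≢0 = -ᶠ-nonzero e λ e≡0 → 1ᶠ≢0ᶠ (trans (sym ek≡1) (trans (cong (_*ᶠ k) e≡0) (*ᶠ-zeroˡ k)))

      -- The coordinates are the residue of `B x` and -1 minus the residue of `A y`, so that
      -- `S (ψ q)` is literally the staircase comparison.
      ψ : 𝔽² → 𝔽²
      ψ (x , y) = b₀ +ᶠ x *ᶠ (-ᶠ k) , ε - (a₀ +ᶠ y *ᶠ k)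

      T⇒S : ∀ q → T (pt q) → S (ψ q)
      T⇒S (x , y) Tq = proj₁ (region x y) (𝟙-yes (T? (pt (x , y))) Tq)

      S⇒T : ∀ q → S (ψ q) → T (pt q)
      S⇒T (x , y) Sq = decidable-stable (T? (pt (x , y)))
        (λ ¬Tq → proj₂ (region x y) (𝟙-no (T? (pt (x , y))) ¬Tq) Sq)

      -- The map `α` has to be `pt` after the inverse of `ψ`. Solving (X , Y) = ψ (x , y) gives x =
      -- (b₀ - X) e and y = (ε - a₀ - Y) e; the constant terms yield the origin `o′`, the
      -- coefficients of X and Y the axes.
      o′ w₁′ w₂′ : 𝔽²
      o′ = frame o w₁ w₂ (b₀ *ᶠ e , (ε - a₀) *ᶠ e)
      w₁′ = (-ᶠ e) · w₁
      w₂′ = (-ᶠ e) · w₂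

      det-w₁′w₂′ : det w₁′ w₂′ ≢ 0ᶠ
      det-w₁′w₂′ = det-scaleˡ (-ᶠ e) w₁ w₂′ -e≢0
        (det-swap w₂′ w₁ (det-scaleˡ (-ᶠ e) w₂ w₁ -e≢0 (det-swap w₁ w₂ det-w₁w₂)))

      α : AGL
      α = frameAGL o′ w₁′ w₂′ det-w₁′w₂′

      α-ψ : ∀ q → AGL.⟦ α ⟧ (ψ q) ≡ pt q
      α-ψ (x , y) = trans (frameAGL-⟦⟧ o′ w₁′ w₂′ det-w₁′w₂′ (ψ (x , y))) (cong₂ _,_
        (component (proj₁ o) (proj₁ w₁) (proj₁ w₂)) (component (proj₂ o) (proj₂ w₁) (proj₂ w₂)))
        where
        component : ∀ o w₁ w₂ →
          o +ᶠ b₀ *ᶠ e *ᶠ w₁ +ᶠ (ε - a₀) *ᶠ e *ᶠ w₂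
            +ᶠ (b₀ +ᶠ x *ᶠ (-ᶠ k)) *ᶠ (-ᶠ e *ᶠ w₁)
            +ᶠ (ε - (a₀ +ᶠ y *ᶠ k)) *ᶠ (-ᶠ e *ᶠ w₂)
          ≡ o +ᶠ x *ᶠ w₁ +ᶠ y *ᶠ w₂
        component o w₁ w₂ = begin
          _ ≡⟨ solve 10 (λ o w₁ w₂ x y a b k e ε →
                 o :+ b :* e :* w₁ :+ (ε :- a) :* e :* w₂
                   :+ (b :+ x :* (:- k)) :* (:- e :* w₁) :+ (ε :- (a :+ y :* k)) :* (:- e :* w₂)
                 := o :+ e :* k :* (x :* w₁) :+ e :* k :* (y :* w₂)) refl o w₁ w₂ x y a₀ b₀ k e ε ⟩
          o +ᶠ e *ᶠ k *ᶠ (x *ᶠ w₁) +ᶠ e *ᶠ k *ᶠ (y *ᶠ w₂)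
            ≡⟨ cong₂ (λ s t → o +ᶠ s +ᶠ t) (unit (x *ᶠ w₁)) (unit (y *ᶠ w₂)) ⟩
          o +ᶠ x *ᶠ w₁ +ᶠ y *ᶠ w₂ ∎
          where
          unit : ∀ z → e *ᶠ k *ᶠ z ≡ z
          unit z = trans (cong (_*ᶠ z) ek≡1) (*ᶠ-identityˡ z)

      preimage : 𝔽² → 𝔽²
      preimage = coords o w₁ w₂ det-w₁w₂

      pt-preimage : ∀ u → pt (preimage u) ≡ u
      pt-preimage = frame-coords o w₁ w₂ det-w₁w₂

      T⊆ : ∀ {u} → T u → image α S u
      T⊆ {u} Tu = ψ (preimage u) , T⇒S (preimage u) (subst T (sym (pt-preimage u)) Tu)
        , sym (trans (α-ψ (preimage u)) (pt-preimage u))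

      ⊆T : ∀ {u} → image α S u → T u
      ⊆T {u} (v , Sv , u≡αv) = subst T (pt-preimage u) (S⇒T (preimage u) (subst S v≡ψ Sv))
        where
        v≡ψ : v ≡ ψ (preimage u)
        v≡ψ = trans (sym (proj₂ (AGL.inverse α) u≡αv))
          (proj₂ (AGL.inverse α) (sym (trans (α-ψ (preimage u)) (pt-preimage u))))

  -- Isolating the three special directions.

  2≤p : 2 ≤ p
  2≤p = nonTrivial⇒n>1 p where instance _ = prime⇒nonTrivial p-prime

  p-2+2≡p : p ∸ 2 + 2 ≡ p
  p-2+2≡p = ℕ.m∸n+n≡m 2≤p

  -- Each of the `p ∸ 2` equidistributed directions contributes N / p to the count through a point.
  -- The count is multiplied by `p` to stay within natural numbers, and `p` is cancelled at the end.
  special-sum : ∀ {s N g} → p * s + (p ∸ 2) * N ≡ p * (N + p * g) → 2 * N ≡ p * (p ∸ 1) →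
                s ≡ p ∸ 1 + p * g
  special-sum {s} {N} {g} eq half = ℕ.*-cancelˡ-≡ s _ p (ℕ.+-cancelʳ-≡ ((p ∸ 2) * N) _ _ (begin
    p * s + (p ∸ 2) * N                          ≡⟨ eq ⟩
    p * (N + p * g)                              ≡⟨ ℕ.*-distribˡ-+ p N (p * g) ⟩
    p * N + p * (p * g)                          ≡⟨ cong (λ q → q * N + p * (p * g)) p-2+2≡p ⟨
    (p ∸ 2 + 2) * N + p * (p * g)                ≡⟨ regroup (p ∸ 2) N (p * (p * g)) ⟩
    2 * N + p * (p * g) + (p ∸ 2) * N
      ≡⟨ cong (λ m → m + p * (p * g) + (p ∸ 2) * N) half ⟩
    p * (p ∸ 1) + p * (p * g) + (p ∸ 2) * N
      ≡⟨ cong (_+ (p ∸ 2) * N) (ℕ.*-distribˡ-+ p (p ∸ 1) (p * g)) ⟨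
    p * (p ∸ 1 + p * g) + (p ∸ 2) * N            ∎))
    where
    regroup : ∀ m N k → (m + 2) * N + k ≡ 2 * N + k + m * N
    regroup = solve-∀

  module _ {T : Pred 𝔽² 0ℓ} (T? : Decidable T) (exact : EquidistributedInExactly (p ∸ 2) T?) where
    open Setoid Direction using () renaming (Carrier to Dir)
    open LineSums (𝟙 ∘ T?)

    private
      ds : List Dir
      ds = proj₁ exact
      length-ds : length ds ≡ p ∸ 2
      length-ds = proj₁ (proj₂ exact)
      ds-unique = proj₁ (proj₂ (proj₂ exact))
      ∈ds⇔ = proj₂ (proj₂ (proj₂ exact))

      slope : Dir → Slope
      slope (v , v≢0) = proj₁ (∥-dir v v≢0)

      ∥-slope : ∀ d → proj₁ d ∥ dir (slope d)
      ∥-slope (v , v≢0) = proj₂ (∥-dir v v≢0)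

      direction : Slope → Dir
      direction s = dir s , dir≢0ᵛ s

      es : List Slope
      es = map slope ds

      es-unique : Unique es
      es-unique = UniqueSetoid.map⁺ Direction (setoid Slope) slope-injective ds-unique
        where
        slope-injective : ∀ {d e} → slope d ≡ slope e → proj₁ d ∥ proj₁ e
        slope-injective {d} {e} eq =
          ∥-trans (subst (λ s → proj₁ d ∥ dir s) eq (∥-slope d)) (∥-sym (∥-slope e))

      length-es : length es ≡ p ∸ 2
      length-es = trans (length-map slope ds) length-ds

      card-dir : ∀ s u → card (T? ∩? line? u (dir s)) ≡ lineSum u (dir s)
      card-dir s u = card-line T? u (dir s) (dir≢0ᵛ s)

      ∈es⇒constant : ∀ {s} → s ∈ es → ∀ u u′ → lineSum u (dir s) ≡ lineSum u′ (dir s)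
      ∈es⇒constant s∈ u u′ with d , d∈ , refl ← ∈-map⁻ slope s∈ =
        trans (sym (card-dir (slope d) u)) (trans (equidistributed u u′) (card-dir (slope d) u′))
        where
        equidistributed : Equidistributed T? (direction (slope d))
        equidistributed = Equivalence.to (∈ds⇔ (direction (slope d)))
          (Any.map (λ { refl → ∥-sym (∥-slope d) }) d∈)

      constant⇒∈es : ∀ {s} → (∀ u u′ → lineSum u (dir s) ≡ lineSum u′ (dir s)) → s ∈ es
      constant⇒∈es {s} constant = member (Equivalence.from (∈ds⇔ (direction s)) λ u u′ →
          trans (card-dir s u) (trans (constant u u′) (sym (card-dir s u′))))
        where
        open Membership Direction using () renaming (_∈_ to _∈ᵈ_)
        member : ∀ {ds} → direction s ∈ᵈ ds → s ∈ map slope ds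
        member {d ∷ _} (here s∥d) = here (dir-injective (∥-trans s∥d (∥-slope d)))
        member (there d∈) = there (member d∈)

      open DecMembership (Maybe.≡-dec (_≟_ {p})) using (_∈?_)

      ∉es? : Decidable (_∉ es)
      ∉es? s = ¬? (s ∈? es)

      special : List Slope
      special = filter ∉es? slopes

      special-unique : Unique special
      special-unique = Unique.filter⁺ ∉es? slopes-unique

      ∈special⇒∉es : ∀ {s} → s ∈ special → s ∉ es
      ∈special⇒∉es s∈ = proj₂ (∈-filter⁻ ∉es? {xs = slopes} s∈)

      slopes-↭ : es ++ special ↭ slopes
      slopes-↭ = unique-↭
        (Unique.++⁺ es-unique special-unique (λ (s∈es , s∈special) → ∈special⇒∉es s∈special s∈es))
        slopes-unique (λ {s} → mk⇔ (λ _ → ∈-slopes s) (λ _ → member s))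
        where
        member : ∀ s → s ∈ es ++ special
        member s with s ∈? es
        ... | yes s∈ = ∈-++⁺ˡ s∈
        ... | no  s∉ = ∈-++⁺ʳ es (∈-filter⁺ ∉es? (∈-slopes s) s∉)

      -- The p + 1 slopes lose p - 2 of them; the truncated subtraction is exact because `2 ≤ p`.
      length-special : length special ≡ 3
      length-special = ℕ.+-cancelˡ-≡ (p ∸ 2) _ 3 (begin
        p ∸ 2 + length special          ≡⟨ cong (_+ length special) length-es ⟨
        length es + length special      ≡⟨ length-++ es ⟨
        length (es ++ special)          ≡⟨ ↭-length slopes-↭ ⟩
        length slopes                   ≡⟨ length-slopes ⟩
        1 + p                           ≡⟨ cong suc p-2+2≡p ⟨
        suc (p ∸ 2 + 2)                 ≡⟨ ℕ.+-suc (p ∸ 2) 2 ⟨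
        p ∸ 2 + 3                       ∎)

      -- The `p` lines parallel to `dir s` partition the plane and have equal sums. They are
      -- enumerated along any direction transversal to `dir s`.
      constant-total : ∀ {s} → s ∈ es → ∀ u → p * lineSum u (dir s) ≡ total
      constant-total {s} s∈ u = let w , det≢0 = transversal s in begin
        p * lineSum u (dir s)                    ≡⟨ ∑ᶠ-const (lineSum u (dir s)) ⟨
        ∑ᶠ (λ _ → lineSum u (dir s))
          ≡⟨ ∑-cong (allFin p) (λ z → ∈es⇒constant s∈ u (u +ᵛ z · w)) ⟩
        ∑ᶠ (λ z → lineSum (u +ᵛ z · w) (dir s))  ≡⟨ lineSum-parallel u w (dir s) det≢0 ⟩
        total                                    ∎
        where
        transversal : ∀ s → ∃ λ w → det w (dir s) ≢ 0ᶠ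
        transversal nothing  = dir (just 0ᶠ) , det-dir (just 0ᶠ) nothing λ ()
        transversal (just m) = dir nothing , det-dir nothing (just m) λ ()

      special-sums : 2 * total ≡ p * (p ∸ 1) → ∀ u →
                     ∑ special (λ s → lineSum u (dir s)) ≡ p ∸ 1 + p * 𝟙 (T? u)
      special-sums half u = special-sum (begin
        p * ∑ special f + (p ∸ 2) * total
          ≡⟨ cong (λ n → p * ∑ special f + n * total) length-es ⟨
        p * ∑ special f + length es * total
          ≡⟨ cong (p * ∑ special f +_) (∑-const es total) ⟨
        p * ∑ special f + ∑ es (λ _ → total)
          ≡⟨ cong (p * ∑ special f +_) (∑-cong∈ es (λ s∈ → constant-total s∈ u)) ⟨
        p * ∑ special f + ∑ es (λ s → p * f s)
          ≡⟨ cong (p * ∑ special f +_) (∑-* p f es) ⟩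
        p * ∑ special f + p * ∑ es f
          ≡⟨ ℕ.*-distribˡ-+ p (∑ special f) (∑ es f) ⟨
        p * (∑ special f + ∑ es f)
          ≡⟨ cong (p *_) (ℕ.+-comm (∑ special f) (∑ es f)) ⟩
        p * (∑ es f + ∑ special f)
          ≡⟨ cong (p *_) (∑-++ f es special) ⟨
        p * ∑ (es ++ special) f
          ≡⟨ cong (p *_) (∑-↭ f slopes-↭) ⟩
        p * ∑ slopes f
          ≡⟨ cong (p *_) (lineSum-slopes u) ⟩
        p * (total + p * 𝟙 (T? u)) ∎) half
        where
        f : Slope → ℕ
        f s = lineSum u (dir s)

      -- The list is a variable here so that its length can be matched against 3; `special` itself
      -- is a filtered list that does not reduce.
      conclude : ∀ ss → length ss ≡ 3 → Unique ss → (∀ {s} → s ∈ ss → s ∉ es) →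
                 (∀ u → ∑ ss (λ s → lineSum u (dir s)) ≡ p ∸ 1 + p * 𝟙 (T? u)) →
                 2 * total ≡ p * (p ∸ 1) → ∃ λ α → T ≐ image α S
      conclude (s₁ ∷ s₂ ∷ s₃ ∷ []) refl ((s₁≢s₂ ∷ s₁≢s₃ ∷ []) ∷ (s₂≢s₃ ∷ []) ∷ _) ∉es sums half =
        three-directions T? (dir s₁) (dir s₂) (dir s₃)
          (det-dir s₁ s₂ s₁≢s₂) (det-dir s₃ s₂ (s₂≢s₃ ∘ sym)) (det-dir s₁ s₃ s₁≢s₃)
          (∉es (here refl) ∘ constant⇒∈es) (∉es (there (here refl)) ∘ constant⇒∈es)
          (∉es (there (there (here refl))) ∘ constant⇒∈es)
          (λ u → trans (flatten (lineSum u (dir s₁)) (lineSum u (dir s₂)) (lineSum u (dir s₃)))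
                       (sums u))
          half
        where
        flatten : ∀ a b c → a + b + c ≡ a + (b + (c + 0))
        flatten = solve-∀

    half⇒S : 2 * card T? ≡ p * (p ∸ 1) → ∃ λ α → T ≐ image α S
    half⇒S half = conclude special length-special special-unique ∈special⇒∉es
      (special-sums half′) half′
      where
      half′ = trans (cong (2 *_) (sym (card-total T?))) half

  -- Passing to the complement.

  𝟙-complement : {A : Set} (A? : Dec A) → 𝟙 (¬? A?) + 𝟙 A? ≡ 1
  𝟙-complement (yes _) = refl
  𝟙-complement (no _)  = refl

  ∑-complement : {A : Set} {P : Pred A 0ℓ} (P? : Decidable P) (xs : List A) →
                 ∑ xs (𝟙 ∘ ∁? P?) + ∑ xs (𝟙 ∘ P?) ≡ length xs
  ∑-complement P? xs = begin
    ∑ xs (𝟙 ∘ ∁? P?) + ∑ xs (𝟙 ∘ P?)       ≡⟨ ∑-+ (𝟙 ∘ ∁? P?) (𝟙 ∘ P?) xs ⟨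
    ∑ xs (λ x → 𝟙 (¬? (P? x)) + 𝟙 (P? x))  ≡⟨ ∑-cong xs (λ x → 𝟙-complement (P? x)) ⟩
    ∑ xs (λ _ → 1)                         ≡⟨ ∑-const xs 1 ⟩
    length xs * 1                          ≡⟨ ℕ.*-identityʳ (length xs) ⟩
    length xs                              ∎

  module _ {T : Pred 𝔽² 0ℓ} (T? : Decidable T) where
    private
      lines : ∀ u v → v ≢ 0ᵛ → card (∁? T? ∩? line? u v) + card (T? ∩? line? u v) ≡ p
      lines u v v≢0 = begin
        card (∁? T? ∩? line? u v) + card (T? ∩? line? u v)
          ≡⟨ cong₂ _+_ (card-line (∁? T?) u v v≢0) (card-line T? u v v≢0) ⟩
        ∑ᶠ (λ t → 𝟙 (¬? (T? (u +ᵛ t · v)))) + ∑ᶠ (λ t → 𝟙 (T? (u +ᵛ t · v)))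
          ≡⟨ ∑-complement (λ t → T? (u +ᵛ t · v)) (allFin p) ⟩
        length (allFin p)
          ≡⟨ length-allFin ⟩
        p ∎

    -- On each line the counts of `T` and of its complement add up to `p`, so one is independent of
    -- the line exactly when the other is.
    equidistributed-∁ : ∀ d → Equidistributed T? d ⇔ Equidistributed (∁? T?) d
    equidistributed-∁ (v , v≢0) = mk⇔
      (λ eq u u′ → ℕ.+-cancelʳ-≡ (card (T? ∩? line? u v)) _ _
        (trans (same u u′) (cong (card (∁? T? ∩? line? u′ v) +_) (eq u′ u))))
      (λ eq u u′ → ℕ.+-cancelˡ-≡ (card (∁? T? ∩? line? u v)) _ _
        (trans (same u u′) (cong (_+ card (T? ∩? line? u′ v)) (eq u′ u))))
      where
      same : ∀ u u′ → card (∁? T? ∩? line? u v) + card (T? ∩? line? u v)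
                    ≡ card (∁? T? ∩? line? u′ v) + card (T? ∩? line? u′ v)
      same u u′ = trans (lines u v v≢0) (sym (lines u′ v v≢0))

    equidistributedInExactly-∁ : ∀ {k} → EquidistributedInExactly k T? →
                                 EquidistributedInExactly k (∁? T?)
    equidistributedInExactly-∁ (ds , length-ds , ds-unique , ∈ds⇔) =
      ds , length-ds , ds-unique , λ d → ⇔-trans (∈ds⇔ d) (equidistributed-∁ d)

    card-∁ : card (∁? T?) + card T? ≡ p * p
    card-∁ = begin
      card (∁? T?) + card T?
        ≡⟨ cong₂ _+_ (length-filter (∁? T?) points) (length-filter T? points) ⟩
      ∑ points (𝟙 ∘ ∁? T?) + ∑ points (𝟙 ∘ T?)
        ≡⟨ ∑-complement T? points ⟩
      length points
        ≡⟨ ℕ.*-identityʳ (length points) ⟨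
      length points * 1
        ≡⟨ ∑-const points 1 ⟨
      ∑ points (λ _ → 1)
        ≡⟨ ∑-cartesianProduct (λ _ → 1) (allFin p) (allFin p) ⟩
      ∑ᶠ (λ _ → ∑ᶠ (λ _ → 1))
        ≡⟨ trans (∑ᶠ-const _) (cong (p *_) (trans (∑ᶠ-const 1) (ℕ.*-identityʳ p))) ⟩
      p * p ∎

  -- A bijection commutes with complements. Decidability of `T` removes the double negation in the
  -- inclusion of the image in `T`.
  ∁-image : {T : Pred 𝔽² 0ℓ} → Decidable T → (α : AGL) → ∁ T ≐ image α S → T ≐ image α (∁ S)
  ∁-image {T} T? α (∁T⊆ , ⊆∁T) = T⊆ , ⊆T
    where
    T⊆ : ∀ {u} → T u → image α (∁ S) u
    T⊆ {u} Tu = v , (λ Sv → ⊆∁T (v , Sv , u≡αv) Tu) , u≡αv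
      where
      v = AffineMap.apply (AGL.from α) u
      u≡αv = sym (proj₁ (AGL.inverse α) refl)
    ⊆T : ∀ {u} → image α (∁ S) u → T u
    ⊆T {u} (v , ¬Sv , u≡αv) = decidable-stable (T? u) λ ¬Tu →
      let v′ , Sv′ , u≡αv′ = ∁T⊆ ¬Tu in
      ¬Sv (subst S (trans (sym (proj₂ (AGL.inverse α) u≡αv′)) (proj₂ (AGL.inverse α) u≡αv)) Sv′)

  -- Evaluating the two cardinalities.

  triangular : ℕ
  triangular = ∑ᶠ toℕ

  half-of : ∀ m → 2 * m / 2 ≡ m
  half-of m = trans (cong (_/ 2) (ℕ.*-comm 2 m)) (ℕ.m*n/n≡m m 2)

  -- The quotient is a floor division, but it is exact since `p * (p ∸ 1)` is twice a triangular
  -- number.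
  small-card : ∀ {n} → n ≡ p * (p ∸ 1) / 2 → 2 * n ≡ p * (p ∸ 1)
  small-card refl = begin
    2 * (p * (p ∸ 1) / 2)        ≡⟨ cong (λ m → 2 * (m / 2)) (2∑toℕ p) ⟨
    2 * (2 * triangular / 2)     ≡⟨ cong (2 *_) (half-of triangular) ⟩
    2 * triangular               ≡⟨ 2∑toℕ p ⟩
    p * (p ∸ 1)                  ∎

  p[p+1] : p * (p + 1) ≡ p * (p ∸ 1) + 2 * p
  p[p+1] = subst (λ q → q * (q + 1) ≡ q * (p ∸ 1) + 2 * q) p-1+1≡p (poly (p ∸ 1))
    where
    poly : ∀ q → (1 + q) * (1 + q + 1) ≡ (1 + q) * q + 2 * (1 + q)
    poly = solve-∀

  -- From p² - p(p + 1)/2 = p(p - 1)/2 the complement has the cardinality of the first case.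
  -- Division by 2 is again exact, as p(p + 1) is twice `triangular + p`.
  large-card : ∀ {m n} → m + n ≡ p * p → n ≡ p * (p + 1) / 2 → 2 * m ≡ p * (p ∸ 1)
  large-card {m} m+n≡p² refl = ℕ.+-cancelʳ-≡ (p * (p ∸ 1) + 2 * p) _ _ (begin
    2 * m + (p * (p ∸ 1) + 2 * p)                  ≡⟨ cong (2 * m +_) 2n ⟨
    2 * m + 2 * (p * (p + 1) / 2)                  ≡⟨ ℕ.*-distribˡ-+ 2 m _ ⟨
    2 * (m + p * (p + 1) / 2)                      ≡⟨ cong (2 *_) m+n≡p² ⟩
    2 * (p * p)                                    ≡⟨ subst square p-1+1≡p (poly (p ∸ 1)) ⟩
    p * (p ∸ 1) + (p * (p ∸ 1) + 2 * p)            ∎)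
    where
    square : ℕ → Set
    square q = 2 * (q * q) ≡ q * (p ∸ 1) + (q * (p ∸ 1) + 2 * q)
    poly : ∀ q → 2 * ((1 + q) * (1 + q)) ≡ (1 + q) * q + ((1 + q) * q + 2 * (1 + q))
    poly = solve-∀
    2n : 2 * (p * (p + 1) / 2) ≡ p * (p ∸ 1) + 2 * p
    2n = begin
      2 * (p * (p + 1) / 2)              ≡⟨ cong (λ k → 2 * (k / 2)) double ⟩
      2 * (2 * (triangular + p) / 2)     ≡⟨ cong (2 *_) (half-of (triangular + p)) ⟩
      2 * (triangular + p)               ≡⟨ trans (sym double) p[p+1] ⟩
      p * (p ∸ 1) + 2 * p                ∎
      where
      double : p * (p + 1) ≡ 2 * (triangular + p)
      double = begin
        p * (p + 1)                ≡⟨ p[p+1] ⟩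
        p * (p ∸ 1) + 2 * p        ≡⟨ cong (_+ 2 * p) (2∑toℕ p) ⟨
        2 * triangular + 2 * p     ≡⟨ ℕ.*-distribˡ-+ 2 triangular p ⟨
        2 * (triangular + p)       ∎

theorem4p1 : (p : ℕ) (p-prime : Prime p) →
    let open Plane p p-prime in
    (T : Pred 𝔽² 0ℓ) (T? : Decidable T) →
    EquidistributedInExactly (p ∸ 2) T? →
    (card T? ≡ p * (p ∸ 1) / 2 → ∃ λ (α : AGL) → T ≐ image α S) ×
    (card T? ≡ p * (p + 1) / 2 → ∃ λ (α′ : AGL) → T ≐ image α′ (∁ S))
theorem4p1 p p-prime T T? exact =
    (λ small → half⇒S T? exact (small-card small))
  , (λ large →
      let α , eq = half⇒S (∁? T?) (equidistributedInExactly-∁ T? exact)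
                     (large-card (card-∁ T?) large)
      in α , ∁-image T? α eq)
  where open Proof p p-prime
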